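{- Let $\mathcal{M}_1=(V,\mathcal{I}_1)$ and $\mathcal{M}_2=(V,\mathcal{I}_2)$ be matroids on a common ground set $V$ with $|V|=n$, accessible through independence oracles, and let $S\in\mathcal{I}_1\cap\mathcal{I}_2$ be a given common independent set with $|S|=r$. There is a deterministic algorithm which uses $O(nr^{2/3}\log r)$ independence queries and either determines that $S$ is a common independent set of maximum cardinality or finds an augmenting path in the exchange graph $G(S)$.
   Context: A matroid $\mathcal{M}=(V,\mathcal{I})$ consists of a finite ground set $V$ and a nonempty, downward closed family $\mathcal{I}\subseteq 2^V$ of independent sets satisfying the exchange property. An independence oracle for $\mathcal{M}_i$ answers, for a queried $X\subseteq V$, whether $X\in\mathcal{I}_i$; cost is measured in number of such queries. For a common independent set $S$, the exchange graph $G(S)$ is the directed graph on vertex set $V\cup\{s,t\}$ (with $s,t$ two new vertices), bipartite between $S$ and $\bar S=V\setminus S$, with edges: $(s,v)$ for $v\in\bar S$ iff $S\cup\{v\}\in\mathcal{I}_1$; $(v,t)$ for $v\in\bar S$ iff $S\cup\{v\}\in\mathcal{I}_2$; $(u,v)$ for $u\in S,v\in\bar S$ iff $(S\setminus\{u\})\cup\{v\}\in\mathcal{I}_1$; $(v,u)$ for $v\in\bar S,u\in S$ iff $(S\setminus\{u\})\cup\{v\}\in\mathcal{I}_2$. Viewing a path as a sequence of vertices, an $(s,t)$-path $p$ is chordless if no proper subsequence of $p$ is also an $(s,t)$-path; a chordless $(s,t)$-path in $G(S)$ is called an augmenting path. -}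

module Defs where

open import Data.Nat using (ℕ; zero; suc; _+_; _*_; _^_; _≤_; _<_)
open import Data.Nat.Logarithm using (⌊log₂_⌋)
open import Data.Bool using (Bool; true; false)
open import Data.Fin using (Fin)
open import Data.Fin.Subset using (Subset; ⊥; ⁅_⁆; _∈_; _∉_; _⊆_; _∪_; _-_; ∣_∣)
open import Data.Product using (_×_; _,_; ∃; proj₁; proj₂)
open import Data.Sum using (_⊎_)
open import Data.List using (List; []; _∷_; length)
open import Data.List.Relation.Unary.Unique.Propositional using (Unique)
open import Data.List.Relation.Binary.Sublist.Propositional using () renaming (_⊆_ to _⊑_)
open import Relation.Binary.PropositionalEquality using (_≡_)
open import Relation.Nullary using (¬_)

record IsMatroid {n : ℕ} (Indep : Subset n → Bool) : Set where
  field
    empty-indep : Indep ⊥ ≡ true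
    down-closed : ∀ (A B : Subset n) → A ⊆ B → Indep B ≡ true → Indep A ≡ true
    exchange    : ∀ (A B : Subset n) → Indep A ≡ true → Indep B ≡ true →
                  ∣ A ∣ < ∣ B ∣ →
                  ∃ λ x → x ∈ B × x ∉ A × Indep (A ∪ ⁅ x ⁆) ≡ true

CommonIndep : {n : ℕ} → (Subset n → Bool) → (Subset n → Bool) → Subset n → Set
CommonIndep I₁ I₂ S = I₁ S ≡ true × I₂ S ≡ true

IsMaxCommonIndep : {n : ℕ} → (Subset n → Bool) → (Subset n → Bool) → Subset n → Set
IsMaxCommonIndep I₁ I₂ S =
  CommonIndep I₁ I₂ S × (∀ T → CommonIndep I₁ I₂ T → ∣ T ∣ ≤ ∣ S ∣)

data Vtx (n : ℕ) : Set where
  s t : Vtx n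
  v   : Fin n → Vtx n

data Edge {n : ℕ} (I₁ I₂ : Subset n → Bool) (S : Subset n) : Vtx n → Vtx n → Set where
  s→ : ∀ {x} → x ∉ S → I₁ (S ∪ ⁅ x ⁆) ≡ true → Edge I₁ I₂ S s (v x)
  →t : ∀ {x} → x ∉ S → I₂ (S ∪ ⁅ x ⁆) ≡ true → Edge I₁ I₂ S (v x) t
  in→out : ∀ {u x} → u ∈ S → x ∉ S → I₁ ((S - u) ∪ ⁅ x ⁆) ≡ true →
           Edge I₁ I₂ S (v u) (v x)
  out→in : ∀ {x u} → x ∉ S → u ∈ S → I₂ ((S - u) ∪ ⁅ x ⁆) ≡ true →
           Edge I₁ I₂ S (v x) (v u)

Walk : {n : ℕ} → (Vtx n → Vtx n → Set) → List (Vtx n) → Set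
Walk E []           = Data.Unit.⊤ where import Data.Unit
Walk E (a ∷ [])     = Data.Unit.⊤ where import Data.Unit
Walk E (a ∷ b ∷ xs) = E a b × Walk E (b ∷ xs)

EndsAt : {A : Set} → A → List A → Set
EndsAt a []           = Data.Empty.⊥ where import Data.Empty
EndsAt a (b ∷ [])     = b ≡ a
EndsAt a (b ∷ c ∷ xs) = EndsAt a (c ∷ xs)

IsSTPath : {n : ℕ} → (Subset n → Bool) → (Subset n → Bool) → Subset n →
           List (Vtx n) → Set
IsSTPath I₁ I₂ S []       = Data.Empty.⊥ where import Data.Empty
IsSTPath I₁ I₂ S (a ∷ xs) =
  a ≡ s × EndsAt t (a ∷ xs) × Unique (a ∷ xs) × Walk (Edge I₁ I₂ S) (a ∷ xs)

IsAugmentingPath : {n : ℕ} → (Subset n → Bool) → (Subset n → Bool) → Subset n →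
                   List (Vtx n) → Set
IsAugmentingPath I₁ I₂ S p =
  IsSTPath I₁ I₂ S p ×
  (∀ q → q ⊑ p → length q < length p → ¬ IsSTPath I₁ I₂ S q)

-- Deterministic oracle algorithms = decision trees over independence
-- queries to M₁ (one) or M₂ (two); the tree may depend on n and S only.

data Which : Set where
  one two : Which

data OracleAlg (n : ℕ) (R : Set) : Set where
  ret : R → OracleAlg n R
  ask : Which → Subset n → (Bool → OracleAlg n R) → OracleAlg n R

oracle : {n : ℕ} → (Subset n → Bool) → (Subset n → Bool) → Which → Subset n → Bool
oracle I₁ I₂ one X = I₁ X
oracle I₁ I₂ two X = I₂ X

output : {n : ℕ} {R : Set} → (Subset n → Bool) → (Subset n → Bool) → OracleAlg n R → R
output I₁ I₂ (ret r)     = r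
output I₁ I₂ (ask w X k) = output I₁ I₂ (k (oracle I₁ I₂ w X))

queries : {n : ℕ} {R : Set} → (Subset n → Bool) → (Subset n → Bool) → OracleAlg n R → ℕ
queries I₁ I₂ (ret r)     = 0
queries I₁ I₂ (ask w X k) = suc (queries I₁ I₂ (k (oracle I₁ I₂ w X)))

data Answer (n : ℕ) : Set where
  maximum   : Answer n
  augmenting : List (Vtx n) → Answer n

Correct : {n : ℕ} → (Subset n → Bool) → (Subset n → Bool) → Subset n → Answer n → Set
Correct I₁ I₂ S maximum        = IsMaxCommonIndep I₁ I₂ S
Correct I₁ I₂ S (augmenting p) = IsAugmentingPath I₁ I₂ S p

-- Query bound  Q ≤ C · n · (r+1)^{2/3} · (1 + ⌊log₂ (r+1)⌋), stated after
-- cubing both sides (to avoid the real exponent 2/3):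
--   Q³ ≤ C · n³ · (r+1)² · (1 + ⌊log₂ (r+1)⌋)³
WithinBound : ℕ → ℕ → ℕ → ℕ → Set
WithinBound C n r Q = Q ^ 3 ≤ C * (n ^ 3 * (suc r) ^ 2 * (suc ⌊log₂ (suc r) ⌋) ^ 3)

{-# OPTIONS --safe #-}
module Submission where

-- Write x → u for an edge from x ∉ S to u ∈ S. One query decides whether x has an edge to (or from)
-- a nonempty set B ⊆ S, since S ∖ B + x is independent iff S - u + x is for some u ∈ B; so a partner
-- of x is found by bisection. Let h ≈ r^{1/3} and grow the set of elements of S seen to be reachable
-- from s. Each x ∉ S collects edges x → u to unseen u until it has h of them ("heavy"), or all edges
-- to unseen elements are known ("light"). An unseen u lying in n/h or more of these lists is skipped;
-- there are at most h² such u at any time, and they are tested one by one once x becomes light.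
-- Hence becoming seen destroys at most n/h + 1 entries, and O(n h²) entries are ever collected.
-- A backward search from the heavy elements and the sinks, passing only through light elements, makes
-- O(n) bisections. If it gets stuck, the marked elements W certify that S is maximum; if it meets a
-- seen element or a source, it yields a walk from s to a sink, or to a heavy element, whereby h
-- further elements become seen. So there are at most h² searches. Finally the walk is made
-- chordless by going from each x to its farthest successor on the walk, and from each next x back to
-- its earliest predecessor; both are found by bisection.

open import Defs
import Algebra.Properties.CommutativeMonoid.Sum
open import Data.Bool using (Bool; true; false; _∧_; _∨_; not; if_then_else_)
import Data.Bool.Properties as Bool
open import Data.Empty using (⊥)
open import Data.Fin using (Fin; zero; suc)
import Data.Fin.Properties as Fin
open import Data.Fin.Subset using (Subset; _∩_; ∁; ⁅_⁆; _∈_; _∉_; _⊆_; _∪_; _-_; ∣_∣; inside; outside)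
open import Data.Fin.Subset.Properties as Subset using (_∈?_)
open import Data.List using (List; []; _∷_; _++_; length; map; filter; tabulate; allFin; take; drop; foldr)
open import Data.List.Membership.Propositional using (find) renaming (_∈_ to _∈ₗ_; _∉_ to _∉ₗ_)
open import Data.List.Membership.Propositional.Properties using (∈-filter⁺; ∈-filter⁻; ∈-allFin; ∈-map⁺; ∈-map⁻; ∈-++⁺ʳ)
open import Data.List.Membership.DecPropositional using () renaming (_∈?_ to mem?)
import Data.List.Properties as List
open import Data.List.Relation.Unary.All as All using (All; []; _∷_)
import Data.List.Relation.Unary.All.Properties as All
open import Data.List.Relation.Unary.AllPairs using ([]; _∷_)
open import Data.List.Relation.Unary.Any as Any using (Any; here; there)
import Data.List.Relation.Unary.Any.Properties as Any
open import Data.List.Relation.Unary.Unique.Propositional using (Unique)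
open import Data.List.Relation.Binary.Sublist.Propositional as Sublist using ([]; _∷_; _∷ʳ_) renaming (_⊆_ to _⊑_)
open import Data.Maybe as Maybe using (Maybe; just; nothing)
open import Data.Nat using (ℕ; zero; suc; _+_; _*_; _^_; _∸_; _≤_; _<_; z≤n; s≤s; _<?_; _≤?_; _/_; _%_)
open import Data.Nat.DivMod using (m≡m%n+[m/n]*n; m%n<n; m/n*n≤m)
open import Data.Nat.Logarithm using (⌊log₂_⌋; ⌊log₂⌋-mono-≤; ⌊log₂[2^n]⌋≡n)
open import Data.Nat.Properties as ℕ using (≤-refl; ≤-trans; ≤-reflexive; +-mono-≤; module ≤-Reasoning)
open import Data.Nat.Solver using (module +-*-Solver)
open import Data.Product using (_×_; _,_; ∃; proj₁; proj₂; map₂)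
open import Data.Sum using (_⊎_; inj₁; inj₂)
open import Data.Unit using (⊤; tt)
open import Data.Vec as Vec using ([]; _∷_; here; there; lookup)
open import Data.Vec.Properties using ([]=⇒lookup; lookup⇒[]=; lookup∘tabulate)
open import Function using (_∘_; id; case_of_)
open import Relation.Binary.PropositionalEquality using (_≡_; _≢_; refl; sym; trans; cong; cong₂; subst)
open import Relation.Nullary using (¬_; Dec; yes; no; does; contradiction)
open import Relation.Nullary.Decidable using (_×-dec_; _⊎-dec_; ¬?)

open Algebra.Properties.CommutativeMonoid.Sum ℕ.+-0-commutativeMonoid using (sum; ∑-distrib-+; ∑-comm)

false≢true : false ≢ true
false≢true ()

≢true : ∀ {b} → b ≢ true → b ≡ false
≢true = Bool.¬-not

-- Finite sums and counting

sum-mono : ∀ {n} {f g : Fin n → ℕ} → (∀ i → f i ≤ g i) → sum f ≤ sum g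
sum-mono {zero}  f≤g = z≤n
sum-mono {suc n} f≤g = +-mono-≤ (f≤g zero) (sum-mono (f≤g ∘ suc))

sum-mono-< : ∀ {n} {f g : Fin n → ℕ} → (∀ i → f i ≤ g i) → ∀ j → f j < g j → sum f < sum g
sum-mono-< {suc n} f≤g zero    fj<gj = +-mono-≤ fj<gj (sum-mono (f≤g ∘ suc))
sum-mono-< {suc n} {f} {g} f≤g (suc j) fj<gj =
  ≤-trans (≤-reflexive (sym (ℕ.+-suc (f zero) _))) (+-mono-≤ (f≤g zero) (sum-mono-< (f≤g ∘ suc) j fj<gj))

sum-bump : ∀ {n} {f g : Fin n → ℕ} j → (∀ i → i ≢ j → g i ≤ f i) → g j ≤ suc (f j) → sum g ≤ suc (sum f)
sum-bump {suc n} zero    off at = +-mono-≤ at (sum-mono (λ i → off (suc i) λ ()))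
sum-bump {suc n} {f} (suc j) off at =
  ≤-trans (+-mono-≤ (off zero λ ()) (sum-bump j (λ i i≢j → off (suc i) (i≢j ∘ Fin.suc-injective)) at))
          (≤-reflexive (ℕ.+-suc (f zero) _))

sum-bounded : ∀ {n} {f : Fin n → ℕ} c → (∀ i → f i ≤ c) → sum f ≤ n * c
sum-bounded {zero}  c f≤c = z≤n
sum-bounded {suc n} c f≤c = +-mono-≤ (f≤c zero) (sum-bounded c (f≤c ∘ suc))

sum-*ʳ : ∀ {n} (f : Fin n → ℕ) c → sum (λ i → f i * c) ≡ sum f * c
sum-*ʳ {zero}  f c = refl
sum-*ʳ {suc n} f c = trans (cong (f zero * c +_) (sum-*ʳ (f ∘ suc) c)) (sym (ℕ.*-distribʳ-+ c (f zero) _))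

⟦_⟧ : Bool → ℕ
⟦ false ⟧ = 0
⟦ true  ⟧ = 1

⟦⟧≤1 : ∀ b → ⟦ b ⟧ ≤ 1
⟦⟧≤1 false = z≤n
⟦⟧≤1 true  = ≤-refl

⟦⟧-mono : ∀ {a b} → (a ≡ true → b ≡ true) → ⟦ a ⟧ ≤ ⟦ b ⟧
⟦⟧-mono {false} a⇒b = z≤n
⟦⟧-mono {true}  a⇒b rewrite a⇒b refl = ≤-refl

⟦⟧-< : ∀ {a b} → a ≡ false → b ≡ true → ⟦ a ⟧ < ⟦ b ⟧
⟦⟧-< refl refl = ≤-refl

# : ∀ {n} → (Fin n → Bool) → ℕ
# p = sum (⟦_⟧ ∘ p)

#-mono : ∀ {n} {p q : Fin n → Bool} → (∀ i → p i ≡ true → q i ≡ true) → # p ≤ # q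
#-mono p⇒q = sum-mono (λ i → ⟦⟧-mono (p⇒q i))

#-mono-< : ∀ {n} {p q : Fin n → Bool} → (∀ i → p i ≡ true → q i ≡ true) →
           ∀ j → p j ≡ false → q j ≡ true → # p < # q
#-mono-< p⇒q j pj qj = sum-mono-< (λ i → ⟦⟧-mono (p⇒q i)) j (⟦⟧-< pj qj)

#-true : ∀ n → # {n} (λ _ → true) ≡ n
#-true zero    = refl
#-true (suc n) = cong suc (#-true n)

#-full : ∀ {n} {p : Fin n → Bool} → n ≤ # p → ∀ i → p i ≢ false
#-full {n} n≤#p i pi = ℕ.<-irrefl refl (≤-trans (#-mono-< (λ _ _ → refl) i pi refl) (≤-trans (≤-reflexive (#-true n)) n≤#p))

#-lookup : ∀ {n} (S : Subset n) → # (lookup S) ≡ ∣ S ∣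
#-lookup []            = refl
#-lookup (outside ∷ S) = #-lookup S
#-lookup (inside  ∷ S) = cong suc (#-lookup S)

#-⊆ : ∀ {n} {p : Fin n → Bool} {S : Subset n} → (∀ i → p i ≡ true → i ∈ S) → # p ≤ ∣ S ∣
#-⊆ {S = S} p⊆S = ≤-trans (#-mono (λ i pi → []=⇒lookup (p⊆S i pi))) (≤-reflexive (#-lookup S))

elements : ∀ {n} → (Fin n → Bool) → List (Fin n)
elements p = filter (λ i → p i Bool.≟ true) (allFin _)

∈-elements⁺ : ∀ {n} {p : Fin n → Bool} {i} → p i ≡ true → i ∈ₗ elements p
∈-elements⁺ {p = p} {i} = ∈-filter⁺ (λ i → p i Bool.≟ true) (∈-allFin i)

∈-elements⁻ : ∀ {n} {p : Fin n → Bool} {i} → i ∈ₗ elements p → p i ≡ true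
∈-elements⁻ {p = p} = proj₂ ∘ ∈-filter⁻ (λ i → p i Bool.≟ true) {xs = allFin _}

length-elements : ∀ {n} (p : Fin n → Bool) → length (elements p) ≡ # p
length-elements p = go p id
  where
  go : ∀ {n m} (p : Fin m → Bool) (f : Fin n → Fin m) →
       length (filter (λ i → p i Bool.≟ true) (tabulate f)) ≡ # (p ∘ f)
  go {zero}  p f = refl
  go {suc n} p f with p (f zero)
  ... | true  = cong suc (go p (f ∘ suc))
  ... | false = go p (f ∘ suc)

_[_≔_] : ∀ {n} {A : Set} → (Fin n → A) → Fin n → A → Fin n → A
(f [ j ≔ a ]) i = if does (i Fin.≟ j) then a else f i

≔-same : ∀ {n} {A : Set} (f : Fin n → A) j a → (f [ j ≔ a ]) j ≡ a
≔-same f j a with j Fin.≟ j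
... | yes _   = refl
... | no  j≢j = contradiction refl j≢j

≔-true : ∀ {n} (p : Fin n → Bool) {i} j → p i ≡ true → (p [ j ≔ true ]) i ≡ true
≔-true p {i} j pi with i Fin.≟ j
... | yes _ = refl
... | no  _ = pi

≔-true⁻ : ∀ {n} (p : Fin n → Bool) {i} j → (p [ j ≔ true ]) i ≡ true → i ≡ j ⊎ p i ≡ true
≔-true⁻ p {i} j pi with i Fin.≟ j
... | yes i≡j = inj₁ i≡j
... | no  _   = inj₂ pi

≔-false⁻ : ∀ {n} (p : Fin n → Bool) {i} j → (p [ j ≔ true ]) i ≡ false → i ≢ j × p i ≡ false
≔-false⁻ p {i} j pi with i Fin.≟ j
... | yes _   = contradiction (sym pi) false≢true
... | no  i≢j = i≢j , pi

-- Oracle programs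

infixl 1 _>>=_
_>>=_ : ∀ {n} {A B : Set} → OracleAlg n A → (A → OracleAlg n B) → OracleAlg n B
ret a     >>= k = k a
ask w X c >>= k = ask w X (λ b → c b >>= k)

filterAsk : ∀ {n} {A : Set} → Which → (A → Subset n) → List A → OracleAlg n (List A)
filterAsk w X []       = ret []
filterAsk w X (a ∷ as) = ask w (X a) λ b → filterAsk w X as >>= λ bs → ret (if b then a ∷ bs else bs)

module _ {n : ℕ} (I₁ I₂ : Subset n → Bool) where

  output->>= : ∀ {A B : Set} (m : OracleAlg n A) (k : A → OracleAlg n B) →
               output I₁ I₂ (m >>= k) ≡ output I₁ I₂ (k (output I₁ I₂ m))
  output->>= (ret a)     k = refl
  output->>= (ask w X c) k = output->>= (c _) k

  queries->>= : ∀ {A B : Set} (m : OracleAlg n A) (k : A → OracleAlg n B) →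
                queries I₁ I₂ (m >>= k) ≡ queries I₁ I₂ m + queries I₁ I₂ (k (output I₁ I₂ m))
  queries->>= (ret a)     k = refl
  queries->>= (ask w X c) k = cong suc (queries->>= (c _) k)

  output-filterAsk : ∀ {A : Set} w (X : A → Subset n) as →
    output I₁ I₂ (filterAsk w X as) ≡ filter (λ a → oracle I₁ I₂ w (X a) Bool.≟ true) as
  output-filterAsk w X [] = refl
  output-filterAsk w X (a ∷ as)
    rewrite output->>= (filterAsk w X as) (λ bs → ret (if oracle I₁ I₂ w (X a) then a ∷ bs else bs))
          | output-filterAsk w X as
    with oracle I₁ I₂ w (X a)
  ... | true  = refl
  ... | false = refl

  queries-filterAsk : ∀ {A : Set} w (X : A → Subset n) as → queries I₁ I₂ (filterAsk w X as) ≡ length as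
  queries-filterAsk w X [] = refl
  queries-filterAsk w X (a ∷ as)
    rewrite queries->>= (filterAsk w X as) (λ bs → ret (if oracle I₁ I₂ w (X a) then a ∷ bs else bs))
          | queries-filterAsk w X as
          = cong suc (ℕ.+-identityʳ _)

  output-filterAsk->>= : ∀ {A B : Set} w (X : A → Subset n) as (k : List A → OracleAlg n B) →
    output I₁ I₂ (filterAsk w X as >>= k) ≡ output I₁ I₂ (k (filter (λ a → oracle I₁ I₂ w (X a) Bool.≟ true) as))
  output-filterAsk->>= w X as k =
    trans (output->>= (filterAsk w X as) k) (cong (output I₁ I₂ ∘ k) (output-filterAsk w X as))

  queries-filterAsk->>= : ∀ {A B : Set} w (X : A → Subset n) as (k : List A → OracleAlg n B) →
    queries I₁ I₂ (filterAsk w X as >>= k) ≡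
    length as + queries I₁ I₂ (k (filter (λ a → oracle I₁ I₂ w (X a) Bool.≟ true) as))
  queries-filterAsk->>= w X as k =
    trans (queries->>= (filterAsk w X as) k) (cong₂ _+_ (queries-filterAsk w X as) (cong (queries I₁ I₂ ∘ k) (output-filterAsk w X as)))

-- Exchange in matroids

infixl 5 _∖_
_∖_ : ∀ {n} → Subset n → List (Fin n) → Subset n
S ∖ B = foldr (λ u T → T - u) S B

∈-⁻ : ∀ {n} (S : Subset n) u {y} → y ∈ S - u → y ∈ S × y ≢ u
∈-⁻ (a ∷ S) zero    (there y∈) = there (Subset.p─q⊆p S _ y∈) , λ ()
∈-⁻ (a ∷ S) (suc u) here       = here , λ ()
∈-⁻ (a ∷ S) (suc u) (there y∈) = let y∈S , y≢u = ∈-⁻ S u y∈ in there y∈S , y≢u ∘ Fin.suc-injective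

∈-∖⁻ : ∀ {n} (S : Subset n) B {y} → y ∈ S ∖ B → y ∈ S × y ∉ₗ B
∈-∖⁻ S []      y∈ = y∈ , λ ()
∈-∖⁻ S (u ∷ B) y∈ with ∈-⁻ (S ∖ B) u y∈
... | y∈S∖B , y≢u with ∈-∖⁻ S B y∈S∖B
... | y∈S , y∉B = y∈S , λ { (here y≡u) → y≢u y≡u ; (there y∈B) → y∉B y∈B }

∈-∖⁺ : ∀ {n} (S : Subset n) B {y} → y ∈ S → y ∉ₗ B → y ∈ S ∖ B
∈-∖⁺ S []      y∈S y∉B = y∈S
∈-∖⁺ S (u ∷ B) y∈S y∉B = Subset.x∈p∧x≢y⇒x∈p-y (∈-∖⁺ S B y∈S (y∉B ∘ there)) (y∉B ∘ here)

∣p∪⁅x⁆∣ : ∀ {n} (p : Subset n) {x} → x ∉ p → ∣ p ∪ ⁅ x ⁆ ∣ ≡ suc ∣ p ∣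
∣p∪⁅x⁆∣ (inside  ∷ p) {zero}  x∉p = contradiction here x∉p
∣p∪⁅x⁆∣ (outside ∷ p) {zero}  x∉p = cong (suc ∘ ∣_∣) (Subset.∪-identityʳ p)
∣p∪⁅x⁆∣ (inside  ∷ p) {suc x} x∉p = cong suc (∣p∪⁅x⁆∣ p (x∉p ∘ there))
∣p∪⁅x⁆∣ (outside ∷ p) {suc x} x∉p = ∣p∪⁅x⁆∣ p (x∉p ∘ there)

∪⁅⁆-⊆ : ∀ {n} {p q : Subset n} {x} → p ⊆ q → x ∈ q → p ∪ ⁅ x ⁆ ⊆ q
∪⁅⁆-⊆ {p = p} {q} {x} p⊆q x∈q y∈ with Subset.x∈p∪q⁻ p ⁅ x ⁆ y∈
... | inj₁ y∈p = p⊆q y∈p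
... | inj₂ y∈x = subst (_∈ q) (sym (Subset.x∈⁅y⁆⇒x≡y x y∈x)) x∈q

∪⁅⁆-mono : ∀ {n} {p q : Subset n} {x} → p ⊆ q → p ∪ ⁅ x ⁆ ⊆ q ∪ ⁅ x ⁆
∪⁅⁆-mono {q = q} {x} p⊆q = ∪⁅⁆-⊆ (Subset.p⊆p∪q _ ∘ p⊆q) (Subset.q⊆p∪q q _ (Subset.x∈⁅x⁆ x))

⊆-⊇-size : ∀ {n} {p q : Subset n} → p ⊆ q → ∣ q ∣ ≤ ∣ p ∣ → q ⊆ p
⊆-⊇-size {p = p} p⊆q ∣q∣≤∣p∣ {x} x∈q with x ∈? p
... | yes x∈p = x∈p
... | no  x∉p = contradiction (Subset.p⊂q⇒∣p∣<∣q∣ (p⊆q , x , x∈q , x∉p)) (ℕ.≤⇒≯ ∣q∣≤∣p∣)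

suc∣p-x∣ : ∀ {n} (p : Subset n) {x} → x ∈ p → suc ∣ p - x ∣ ≡ ∣ p ∣
suc∣p-x∣ p {x} x∈p = trans (sym (∣p∪⁅x⁆∣ (p - x) (λ x∈ → proj₂ (∈-⁻ p x x∈) refl))) (cong ∣_∣ (Subset.⊆-antisym
  (∪⁅⁆-⊆ (proj₁ ∘ ∈-⁻ p x) x∈p) put-back))
  where
  put-back : p ⊆ (p - x) ∪ ⁅ x ⁆
  put-back {y} y∈p with y Fin.≟ x
  ... | yes refl = Subset.q⊆p∪q (p - x) _ (Subset.x∈⁅x⁆ x)
  ... | no  y≢x  = Subset.p⊆p∪q _ (Subset.x∈p∧x≢y⇒x∈p-y y∈p y≢x)

unique⇒length≤ : ∀ {n} (S : Subset n) {us} → Unique us → All (_∈ S) us → length us ≤ ∣ S ∣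
unique⇒length≤ S []         []         = z≤n
unique⇒length≤ S (u≢ ∷ uniq) (u∈S ∷ us∈S) = ≤-trans
  (s≤s (unique⇒length≤ (S - _) uniq (All.zipWith (λ (y∈S , u≢y) → Subset.x∈p∧x≢y⇒x∈p-y y∈S (u≢y ∘ sym)) (us∈S , u≢))))
  (≤-reflexive (suc∣p-x∣ S u∈S))

module _ {n} {I : Subset n → Bool} (mat : IsMatroid I) where
  open IsMatroid mat

  down : ∀ {p q : Subset n} → p ⊆ q → I q ≡ true → I p ≡ true
  down = down-closed _ _

  module _ {S : Subset n} (IS : I S ≡ true) {x} (x∉S : x ∉ S) where

    -- Augment T from S until it has the size of S; then it is S - u + x.
    swap-from : ∀ d (T : Subset n) → d + ∣ T ∣ ≡ ∣ S ∣ → x ∈ T → T ⊆ S ∪ ⁅ x ⁆ → I T ≡ true →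
                ∃ λ u → u ∈ S × u ∉ T × I ((S - u) ∪ ⁅ x ⁆) ≡ true
    swap-from (suc d) T eq x∈T T⊆ IT
      with exchange T S IT IS (≤-trans (s≤s (ℕ.m≤n+m ∣ T ∣ d)) (≤-reflexive eq))
    ... | y , y∈S , y∉T , ITy
      with swap-from d (T ∪ ⁅ y ⁆) (trans (cong (d +_) (∣p∪⁅x⁆∣ T y∉T)) (trans (ℕ.+-suc d _) eq))
             (Subset.p⊆p∪q _ x∈T) (∪⁅⁆-⊆ T⊆ (Subset.p⊆p∪q _ y∈S)) ITy
    ... | u , u∈S , u∉Ty , swap = u , u∈S , (λ u∈T → u∉Ty (Subset.p⊆p∪q _ u∈T)) , swap
    -- Now T has as many elements as S and contains x, so it misses some u of S; otherwise S + x
    -- would fit into T. Then T lies in S - u + x, which has the same size, so the two coincide.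
    swap-from zero T eq x∈T T⊆ IT with Fin.any? (λ u → (u ∈? S) ×-dec ¬? (u ∈? T))
    ... | no  none = contradiction
      (≤-trans (≤-reflexive (sym (∣p∪⁅x⁆∣ S x∉S))) (≤-trans (Subset.p⊆q⇒∣p∣≤∣q∣ (∪⁅⁆-⊆ S⊆T x∈T)) (≤-reflexive eq)))
      (ℕ.<-irrefl refl)
      where
      S⊆T : S ⊆ T
      S⊆T {u} u∈S with u ∈? T
      ... | yes u∈T = u∈T
      ... | no  u∉T = contradiction (u , u∈S , u∉T) none
    ... | yes (u , u∈S , u∉T) = u , u∈S , u∉T , down (⊆-⊇-size T⊆S-u+x size) IT
      where
      T⊆S-u+x : T ⊆ (S - u) ∪ ⁅ x ⁆
      T⊆S-u+x {y} y∈T with Subset.x∈p∪q⁻ S ⁅ x ⁆ (T⊆ y∈T)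
      ... | inj₁ y∈S = Subset.p⊆p∪q _ (Subset.x∈p∧x≢y⇒x∈p-y y∈S λ { refl → u∉T y∈T })
      ... | inj₂ y∈x = Subset.q⊆p∪q (S - u) _ y∈x
      size : ∣ (S - u) ∪ ⁅ x ⁆ ∣ ≤ ∣ T ∣
      size = ≤-reflexive (trans (∣p∪⁅x⁆∣ (S - u) (x∉S ∘ proj₁ ∘ ∈-⁻ S u)) (trans (suc∣p-x∣ S u∈S) (sym eq)))

    -- Since B meets S, the set S minus B plus x is no larger than S, and `swap-from` applies. The u
    -- it yields lies in S but not in S minus B, hence in B. With the converse below, one query
    -- tests a whole group of candidates.
    ∖-indep⇒swap : ∀ {B} → Any (_∈ S) B → I ((S ∖ B) ∪ ⁅ x ⁆) ≡ true →
                   ∃ λ u → u ∈ₗ B × I ((S - u) ∪ ⁅ x ⁆) ≡ true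
    ∖-indep⇒swap {B} B∩S IT with find B∩S
    ... | b , b∈B , b∈S
      with swap-from (∣ S ∣ ∸ ∣ (S ∖ B) ∪ ⁅ x ⁆ ∣) _ (ℕ.m∸n+n≡m T≤S) (Subset.q⊆p∪q (S ∖ B) _ (Subset.x∈⁅x⁆ x))
             (∪⁅⁆-mono (proj₁ ∘ ∈-∖⁻ S B)) IT
      where
      T≤S : ∣ (S ∖ B) ∪ ⁅ x ⁆ ∣ ≤ ∣ S ∣
      T≤S = ≤-trans (Subset.p⊆q⇒∣p∣≤∣q∣ {q = (S - b) ∪ ⁅ x ⁆} (∪⁅⁆-mono {p = S ∖ B} {S - b} {x} λ y∈ → let y∈S , y∉B = ∈-∖⁻ S B y∈ in
                      Subset.x∈p∧x≢y⇒x∈p-y y∈S λ { refl → y∉B b∈B }))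
                    (≤-reflexive (trans (∣p∪⁅x⁆∣ (S - b) (x∉S ∘ proj₁ ∘ ∈-⁻ S b)) (suc∣p-x∣ S b∈S)))
    ... | u , u∈S , u∉T , swap with mem? Fin._≟_ u B
    ... | yes u∈B = u , u∈B , swap
    ... | no  u∉B = contradiction (Subset.p⊆p∪q _ (∈-∖⁺ S B u∈S u∉B)) u∉T

    swap⇒∖-indep : ∀ {B u} → u ∈ₗ B → I ((S - u) ∪ ⁅ x ⁆) ≡ true → I ((S ∖ B) ∪ ⁅ x ⁆) ≡ true
    swap⇒∖-indep {B} {u} u∈B = down (∪⁅⁆-mono {p = S ∖ B} {S - u} λ y∈ → let y∈S , y∉B = ∈-∖⁻ S B y∈ in
      Subset.x∈p∧x≢y⇒x∈p-y y∈S λ { refl → y∉B u∈B })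

-- Certificates of maximality

∣p∩q∣+∣p∩∁q∣ : ∀ {n} (p q : Subset n) → ∣ p ∩ q ∣ + ∣ p ∩ ∁ q ∣ ≡ ∣ p ∣
∣p∩q∣+∣p∩∁q∣ []            []            = refl
∣p∩q∣+∣p∩∁q∣ (outside ∷ p) (_ ∷ q)       = ∣p∩q∣+∣p∩∁q∣ p q
∣p∩q∣+∣p∩∁q∣ (inside ∷ p)  (inside ∷ q)  = cong suc (∣p∩q∣+∣p∩∁q∣ p q)
∣p∩q∣+∣p∩∁q∣ (inside ∷ p)  (outside ∷ q) = trans (ℕ.+-suc _ _) (cong suc (∣p∩q∣+∣p∩∁q∣ p q))

-- The hypothesis on W says that S ∩ W spans W. If T ∩ W were larger, the exchange property would
-- add to S ∩ W an element of W that is not in S.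
spanning-side : ∀ {n} {I : Subset n → Bool} → IsMatroid I → ∀ {S T} → I S ≡ true → I T ≡ true → ∀ W →
                (∀ x → x ∈ W → x ∉ S → I ((S ∩ W) ∪ ⁅ x ⁆) ≢ true) → ∣ T ∩ W ∣ ≤ ∣ S ∩ W ∣
spanning-side mat {S} {T} IS IT W spans with ∣ T ∩ W ∣ ≤? ∣ S ∩ W ∣
... | yes ≤ = ≤
... | no  ≰ with IsMatroid.exchange mat (S ∩ W) (T ∩ W)
                  (down mat (proj₁ ∘ Subset.x∈p∩q⁻ S W) IS) (down mat (proj₁ ∘ Subset.x∈p∩q⁻ T W) IT) (ℕ.≰⇒> ≰)
... | x , x∈T∩W , x∉S∩W , indep = let x∈W = proj₂ (Subset.x∈p∩q⁻ T W x∈T∩W) in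
  contradiction indep (spans x x∈W λ x∈S → x∉S∩W (Subset.x∈p∩q⁺ (x∈S , x∈W)))

-- Weak duality of matroid intersection: the size of T is at most the rank of W in the first matroid
-- plus the rank of its complement in the second, and the two parts of S attain these ranks.
maximum-certificate : ∀ {n} {I₁ I₂ : Subset n → Bool} → IsMatroid I₁ → IsMatroid I₂ →
  ∀ {S} → CommonIndep I₁ I₂ S → ∀ W →
  (∀ x → x ∈ W   → x ∉ S → I₁ ((S ∩ W)   ∪ ⁅ x ⁆) ≢ true) →
  (∀ x → x ∈ ∁ W → x ∉ S → I₂ ((S ∩ ∁ W) ∪ ⁅ x ⁆) ≢ true) →
  IsMaxCommonIndep I₁ I₂ S
maximum-certificate mat₁ mat₂ {S} (I₁S , I₂S) W span₁ span₂ = (I₁S , I₂S) , λ T (I₁T , I₂T) → begin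
  ∣ T ∣                     ≡⟨ ∣p∩q∣+∣p∩∁q∣ T W ⟨
  ∣ T ∩ W ∣ + ∣ T ∩ ∁ W ∣   ≤⟨ +-mono-≤ (spanning-side mat₁ I₁S I₁T W span₁) (spanning-side mat₂ I₂S I₂T (∁ W) span₂) ⟩
  ∣ S ∩ W ∣ + ∣ S ∩ ∁ W ∣   ≡⟨ ∣p∩q∣+∣p∩∁q∣ S W ⟩
  ∣ S ∣                     ∎
  where open ≤-Reasoning

-- Binary search for exchange partners

-- The entries after the hit are what remains of a tail or a stack once it is cut there. That they
-- contain no hit later yields the absence of chords.
data Last {A : Set} (p : A → Bool) (B : List A) : Maybe (A × List A) → Set where
  none : All (λ a → p a ≡ false) B → Last p B nothing
  some : ∀ {pre a post} → B ≡ pre ++ a ∷ post → p a ≡ true → All (λ a → p a ≡ false) post → Last p B (just (a , post))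

Last-++ʳ : ∀ {A : Set} {p : A → Bool} B₁ {B₂ r} → Any (λ a → p a ≡ true) B₂ → Last p B₂ r → Last p (B₁ ++ B₂) r
Last-++ʳ B₁ hit (none miss) = contradiction (All.All¬⇒¬Any (All.map (λ eq eq′ → false≢true (trans (sym eq) eq′)) miss) hit) λ ()
Last-++ʳ B₁ hit (some {pre} refl pa post) = some (sym (List.++-assoc B₁ pre _)) pa post

Last-++ˡ : ∀ {A : Set} {p : A → Bool} {B₁ B₂ r} → All (λ a → p a ≡ false) B₂ → Last p B₁ r →
           Last p (B₁ ++ B₂) (Maybe.map (map₂ (_++ B₂)) r)
Last-++ˡ miss (none miss′) = none (All.++⁺ miss′ miss)
Last-++ˡ miss (some {pre} refl pa post) = some (List.++-assoc pre _ _) pa (All.++⁺ post miss)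

module _ {n : ℕ} (S : Subset n) where

  -- All searched lists have at most r entries, and r < 2 ^ depth.
  depth : ℕ
  depth = suc ⌊log₂ suc ∣ S ∣ ⌋

  module _ {A : Set} (w : Which) (x : Fin n) (key : A → Fin n) where

    -- Meant for lists known to contain a partner, so a single remaining entry needs no query. The
    -- later half is tested first in order to find the last partner; if it has none, the earlier
    -- half must have one.
    bisect : ℕ → List A → OracleAlg n (Maybe (A × List A))
    halves : ℕ → List A → List A → OracleAlg n (Maybe (A × List A))

    bisect k       []       = ret nothing
    bisect zero    (a ∷ as) = ret (just (a , as))
    bisect (suc k) (a ∷ as) = halves k (take (2 ^ k) (a ∷ as)) (drop (2 ^ k) (a ∷ as))

    halves k B₁ []       = bisect k B₁
    halves k B₁ (b ∷ B₂) = ask w ((S ∖ map key (b ∷ B₂)) ∪ ⁅ x ⁆) λ indep →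
      if indep then bisect k (b ∷ B₂) else (bisect k B₁ >>= λ r → ret (Maybe.map (map₂ (_++ b ∷ B₂)) r))

    -- The last entry u of a list of elements of S with S - u + x independent, and the entries after it.
    findLast : List A → OracleAlg n (Maybe (A × List A))
    findLast []       = ret nothing
    findLast (b ∷ B)  = ask w ((S ∖ map key (b ∷ B)) ∪ ⁅ x ⁆) λ indep →
      if indep then bisect depth (b ∷ B) else ret nothing

module FindLast {n : ℕ} {I₁ I₂ : Subset n → Bool} (mat₁ : IsMatroid I₁) (mat₂ : IsMatroid I₂)
                {S : Subset n} (common : CommonIndep I₁ I₂ S) where

  I : Which → Subset n → Bool
  I = oracle I₁ I₂

  mat : ∀ w → IsMatroid (I w)
  mat one = mat₁
  mat two = mat₂

  I-S : ∀ w → I w S ≡ true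
  I-S one = proj₁ common
  I-S two = proj₂ common

  swap : Which → Fin n → Fin n → Bool
  swap w x u = I w ((S - u) ∪ ⁅ x ⁆)

  module _ {A : Set} (w : Which) {x : Fin n} (x∉S : x ∉ S) (key : A → Fin n) where

    private
      p : A → Bool
      p = swap w x ∘ key

    group-hit : ∀ {b B} → key b ∈ S → I w ((S ∖ map key (b ∷ B)) ∪ ⁅ x ⁆) ≡ true → Any (λ a → p a ≡ true) (b ∷ B)
    group-hit b∈S indep with ∖-indep⇒swap (mat w) (I-S w) x∉S (here b∈S) indep
    ... | u , u∈ , sw with ∈-map⁻ key u∈
    ... | a , a∈ , refl = Any.map (λ { refl → sw }) a∈

    group-miss : ∀ {B} → I w ((S ∖ map key B) ∪ ⁅ x ⁆) ≡ false → All (λ a → p a ≡ false) B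
    group-miss dep = All.tabulate λ {a} a∈ → ≢true λ sw →
      false≢true (trans (sym dep) (swap⇒∖-indep (mat w) (I-S w) x∉S (∈-map⁺ key a∈) sw))

    bisect-spec : ∀ k B → All ((_∈ S) ∘ key) B → length B ≤ 2 ^ k → Any (λ a → p a ≡ true) B →
      Last p B (output I₁ I₂ (bisect S w x key k B)) × queries I₁ I₂ (bisect S w x key k B) ≤ k
    halves-spec : ∀ k B₁ B₂ → All ((_∈ S) ∘ key) (B₁ ++ B₂) → length B₁ ≤ 2 ^ k → length B₂ ≤ 2 ^ k →
      Any (λ a → p a ≡ true) (B₁ ++ B₂) →
      Last p (B₁ ++ B₂) (output I₁ I₂ (halves S w x key k B₁ B₂)) × queries I₁ I₂ (halves S w x key k B₁ B₂) ≤ suc k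

    bisect-spec zero (a ∷ [])     B∈S len (here pa) = some {pre = []} refl pa [] , z≤n
    bisect-spec zero (a ∷ b ∷ as) B∈S (s≤s ()) hit
    bisect-spec (suc k) B@(a ∷ as) B∈S len hit =
      subst (λ L → Last p L (output I₁ I₂ (halves S w x key k (take (2 ^ k) B) (drop (2 ^ k) B))) ×
                     queries I₁ I₂ (halves S w x key k (take (2 ^ k) B) (drop (2 ^ k) B)) ≤ suc k) (List.take++drop≡id (2 ^ k) B)
        (halves-spec k (take (2 ^ k) B) (drop (2 ^ k) B) (subst (All _) split B∈S)
          (≤-trans (≤-reflexive (List.length-take (2 ^ k) B)) (ℕ.m⊓n≤m _ _))
          (≤-trans (≤-reflexive (List.length-drop (2 ^ k) B)) (≤-trans (ℕ.∸-monoˡ-≤ (2 ^ k) len)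
            (≤-reflexive (trans (ℕ.m+n∸m≡n (2 ^ k) _) (ℕ.+-identityʳ _)))))
          (subst (Any _) split hit))
      where split = sym (List.take++drop≡id (2 ^ k) B)

    halves-spec k B₁ [] B∈S len₁ len₂ hit rewrite List.++-identityʳ B₁ =
      map₂ ℕ.m≤n⇒m≤1+n (bisect-spec k B₁ B∈S len₁ hit)
    halves-spec k B₁ (b ∷ B₂) B∈S len₁ len₂ hit
      with I w ((S ∖ map key (b ∷ B₂)) ∪ ⁅ x ⁆) in indep
    ... | true =
      let B₂∈S = All.++⁻ʳ B₁ B∈S
          hit₂ = group-hit (All.head B₂∈S) indep
          last , cost = bisect-spec k (b ∷ B₂) B₂∈S len₂ hit₂
      in Last-++ʳ B₁ hit₂ last , s≤s cost
    ... | false rewrite output->>= I₁ I₂ (bisect S w x key k B₁) (λ r → ret (Maybe.map (map₂ (_++ b ∷ B₂)) r))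
                      | queries->>= I₁ I₂ (bisect S w x key k B₁) (λ r → ret (Maybe.map (map₂ (_++ b ∷ B₂)) r))
                      | ℕ.+-identityʳ (queries I₁ I₂ (bisect S w x key k B₁)) =
      let miss = group-miss indep
          last , cost = bisect-spec k B₁ (All.++⁻ˡ B₁ B∈S) len₁ (hit₁ miss (Any.++⁻ B₁ hit))
      in Last-++ˡ miss last , s≤s cost
      where
      hit₁ : ∀ {B₂} → All (λ a → p a ≡ false) B₂ → Any (λ a → p a ≡ true) B₁ ⊎ Any (λ a → p a ≡ true) B₂ →
             Any (λ a → p a ≡ true) B₁
      hit₁ miss (inj₁ hit) = hit
      hit₁ miss (inj₂ hit) = contradiction hit (All.All¬⇒¬Any (All.map (λ eq eq′ → false≢true (trans (sym eq) eq′)) miss))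

    findLast-spec : ∀ B → All ((_∈ S) ∘ key) B → length B ≤ ∣ S ∣ →
      Last p B (output I₁ I₂ (findLast S w x key B)) × queries I₁ I₂ (findLast S w x key B) ≤ suc (depth S)
    findLast-spec []      B∈S len = none [] , z≤n
    findLast-spec (b ∷ B) B∈S len with I w ((S ∖ map key (b ∷ B)) ∪ ⁅ x ⁆) in indep
    ... | false = none (group-miss indep) , s≤s z≤n
    ... | true  = map₂ s≤s (bisect-spec (depth S) (b ∷ B) B∈S (≤-trans len (ℕ.<⇒≤ (≤-trans (s≤s (ℕ.n≤1+n _)) (n<2^suc-log₂ (suc ∣ S ∣)))))
                              (group-hit (All.head B∈S) indep))
      where
      n<2^suc-log₂ : ∀ m → m < 2 ^ suc ⌊log₂ m ⌋
      n<2^suc-log₂ m with m <? 2 ^ suc ⌊log₂ m ⌋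
      ... | yes < = <
      -- Taking logarithms of the opposite inequality gives `suc ⌊log₂ m ⌋ ≤ ⌊log₂ m ⌋`.
      ... | no  ≮ = contradiction (≤-trans (≤-reflexive (sym (⌊log₂[2^n]⌋≡n (suc ⌊log₂ m ⌋)))) (⌊log₂⌋-mono-≤ (ℕ.≮⇒≥ ≮))) (ℕ.<-irrefl refl)

-- Augmenting paths from walks

-- A stack lists pairs (x , u) of a walk s → ⋯ → x → u → ⋯ with the latest pair first;
-- a tail lists pairs (u , x) of a walk → u → x → ⋯ → t in order.

build : ∀ {n} → List (Fin n × Fin n) → Fin n → List (Vtx n) → List (Vtx n)
build []             x p = s ∷ v x ∷ p
build ((x′ , u) ∷ σ) x p = build σ x′ (v u ∷ v x ∷ p)

infix 4 _∈?ₗ_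
_∈?ₗ_ : ∀ {n} (x : Fin n) xs → Dec (x ∈ₗ xs)
_∈?ₗ_ = mem? Fin._≟_

-- If the walk returns to u, the first visit to u continues with what follows the later one.
cut : ∀ {n} → Fin n → List (Fin n × Fin n) → List (Fin n × Fin n) → List (Fin n × Fin n)
cut u whole []                = whole
cut u whole ((u′ , x′) ∷ ρ) = if does (u Fin.≟ u′) then (u′ , x′) ∷ ρ else cut u whole ρ

-- Leaves pairwise distinct elements of S on the tail, hence at most r pairs. This bounds the rounds
-- of `shorten` as well as the lists it searches.
dedupe : ∀ {n} → List (Fin n × Fin n) → List (Fin n × Fin n)
dedupe []              = []
dedupe ((u , x′) ∷ ρ) = cut u ((u , x′) ∷ dedupe ρ) (dedupe ρ)

module _ {n : ℕ} (S : Subset n) (sources targets : List (Fin n)) where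

  -- σ is the part of the path built so far, x the current vertex and ρ the walk still ahead. The
  -- fuel stays at least the length of ρ, so at fuel zero x is a target. The empty list stands for
  -- failed searches, which the invariants of `shorten-spec` exclude.
  shorten : ℕ → List (Fin n × Fin n) → Fin n → List (Fin n × Fin n) → OracleAlg n (List (Vtx n))
  advance : ∀ {x} → ℕ → List (Fin n × Fin n) → List (Fin n × Fin n) → Dec (x ∈ₗ targets) → OracleAlg n (List (Vtx n))
  jump    : ℕ → List (Fin n × Fin n) → Fin n → Maybe ((Fin n × Fin n) × List (Fin n × Fin n)) → OracleAlg n (List (Vtx n))
  retreat : ∀ {x} → ℕ → List (Fin n × Fin n) → List (Fin n × Fin n) → Dec (x ∈ₗ sources) → OracleAlg n (List (Vtx n))
  pop     : ℕ → Fin n → List (Fin n × Fin n) → Maybe ((Fin n × Fin n) × List (Fin n × Fin n)) → OracleAlg n (List (Vtx n))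

  shorten f σ x ρ = advance f σ ρ (x ∈?ₗ targets)

  advance {x} zero    σ ρ _       = ret (build σ x (t ∷ []))
  advance {x} (suc f) σ ρ (yes _) = ret (build σ x (t ∷ []))
  advance {x} (suc f) σ ρ (no  _) = findLast S two x proj₁ ρ >>= jump f σ x

  jump f σ x nothing                  = ret []
  jump f σ x (just ((u , x′) , ρ′)) = retreat f ((x , u) ∷ σ) ρ′ (x′ ∈?ₗ sources)

  -- A source is entered directly from s, so the whole stack is dropped.
  retreat {x} f σ ρ (yes _) = shorten f [] x ρ
  -- The stack lists its latest pair first, so the last hit is the earliest predecessor of x.
  retreat {x} f σ ρ (no  _) = findLast S one x proj₂ σ >>= pop f x ρ

  pop f x ρ nothing         = ret []
  pop f x ρ (just (a , σ)) = shorten f (a ∷ σ) x ρ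

forward : ∀ {n} → List (Fin n × Fin n) → Fin n → List (Fin n × Fin n) → Fin n × List (Fin n × Fin n)
forward []            x ρ = x , ρ
forward ((y , u) ∷ σ) x ρ = forward σ y ((u , x) ∷ ρ)

augment : ∀ {n} → Subset n → (sources targets : List (Fin n)) → List (Fin n × Fin n) → Fin n → OracleAlg n (List (Vtx n))
augment S sources targets σ w =
  let x , ρ = forward σ w [] in shorten S sources targets (length (dedupe ρ)) [] x (dedupe ρ)

-- Correctness and cost of the shortening

record Table {n} (I : Subset n → Bool) (S : Subset n) (xs : List (Fin n)) : Set where
  field
    sound    : ∀ {x} → x ∈ₗ xs → I (S ∪ ⁅ x ⁆) ≡ true
    complete : ∀ {x} → I (S ∪ ⁅ x ⁆) ≡ true → x ∈ₗ xs

module Shorten {n : ℕ} {I₁ I₂ : Subset n → Bool} (mat₁ : IsMatroid I₁) (mat₂ : IsMatroid I₂)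
               {S : Subset n} (common : CommonIndep I₁ I₂ S)
               {sources targets : List (Fin n)} (src : Table I₁ S sources) (tgt : Table I₂ S targets) where

  open FindLast mat₁ mat₂ common

  E : Vtx n → Vtx n → Set
  E = Edge I₁ I₂ S

  -- Excludes forward chords only: a subsequence keeps the order of the path, so these are the
  -- possible shortcuts.
  NoSkip : List (Vtx n) → Set
  NoSkip (a ∷ b ∷ p) = All (λ c → ¬ E a c) p × NoSkip (b ∷ p)
  NoSkip _           = ⊤

  ¬E→s : ∀ {a} → ¬ E a s
  ¬E→s ()

  ¬Et→ : ∀ {a} → ¬ E t a
  ¬Et→ ()

  -- If b occurred again, the edge into its first occurrence would also be an edge from the same
  -- predecessor to the later one, which is a skip.
  NoSkip⇒unique : ∀ a p → Walk E (a ∷ p) → NoSkip (a ∷ p) → Unique p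
  NoSkip⇒unique a []      walk         noskip          = []
  NoSkip⇒unique a (b ∷ p) (ab , walk) (skip , noskip) =
    All.map (λ { ¬ac refl → ¬ac ab }) skip ∷ NoSkip⇒unique b p walk noskip

  s∉walk : ∀ a p → Walk E (a ∷ p) → All (s ≢_) p
  s∉walk a []      walk        = []
  s∉walk a (b ∷ p) (ab , walk) = (λ { refl → ¬E→s ab }) ∷ s∉walk b p walk

  s∉sublist : ∀ {q p : List (Vtx n)} → All (s ≢_) p → s ∷ q ⊑ p → ⊥
  s∉sublist (s≢ ∷ s≢s) (b ∷ʳ q⊑p)   = s∉sublist s≢s q⊑p
  s∉sublist (s≢ ∷ s≢s) (refl ∷ q⊑p) = s≢ refl

  -- The second vertex of the subsequence must be that of the path, for an edge to any later vertex
  -- is a skip. The subsequence cannot stop early either, since t has no outgoing edge.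
  NoSkip-rigid : ∀ {a q p} → Walk E (a ∷ p) → NoSkip (a ∷ p) → EndsAt t (a ∷ q) → Walk E (a ∷ q) → q ⊑ p → q ≡ p
  NoSkip-rigid {q = []} {[]}    walk noskip end walk′ q⊑p = refl
  NoSkip-rigid {q = []} {b ∷ p} (ab , _) noskip refl walk′ q⊑p = contradiction ab ¬Et→
  NoSkip-rigid {q = c ∷ q} {b ∷ p} walk (skip , _) end (ac , _) (b ∷ʳ q⊑p) =
    contradiction ac (All.lookup skip (Sublist.lookup q⊑p (here refl)))
  NoSkip-rigid {q = c ∷ q} {b ∷ p} (_ , walk) (_ , noskip) end (_ , walk′) (refl ∷ q⊑p) =
    cong (b ∷_) (NoSkip-rigid walk noskip end walk′ q⊑p)

  NoSkip⇒augmenting : ∀ p → EndsAt t (s ∷ p) → Walk E (s ∷ p) → NoSkip (s ∷ p) → IsAugmentingPath I₁ I₂ S (s ∷ p)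
  NoSkip⇒augmenting p end walk noskip =
    (refl , end , s∉walk s p walk ∷ NoSkip⇒unique s p walk noskip , walk) , chordless
    where
    chordless : ∀ q → q ⊑ s ∷ p → length q < length (s ∷ p) → ¬ IsSTPath I₁ I₂ S q
    chordless (_ ∷ q) (_ ∷ʳ q⊑p)   len (refl , _)             = s∉sublist {q} (s∉walk s p walk) q⊑p
    chordless (_ ∷ q) (refl ∷ q⊑p) len (_ , end′ , _ , walk′) =
      ℕ.<-irrefl (cong (length ∘ (s ∷_)) (NoSkip-rigid walk noskip end′ walk′ q⊑p)) len

  -- R is the property of the last vertex: being a target during the shortening, being a root during
  -- the search.
  data Tail (R : Fin n → Set) : Fin n → List (Fin n × Fin n) → Set where
    stop : ∀ {x} → x ∉ S → R x → Tail R x []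
    step : ∀ {x u x′ ρ} → x ∉ S → u ∈ S → swap two x u ≡ true × swap one x′ u ≡ true → Tail R x′ ρ →
              Tail R x ((u , x′) ∷ ρ)

  tail-∉ : ∀ {R x ρ} → Tail R x ρ → x ∉ S
  tail-∉ (stop x∉S _)       = x∉S
  tail-∉ (step x∉S _ _ _) = x∉S

  tail-∈ : ∀ {R x ρ} → Tail R x ρ → All (λ (u , _) → u ∈ S) ρ
  tail-∈ (stop _ _)         = []
  tail-∈ (step _ u∈S _ τ) = u∈S ∷ tail-∈ τ

  tail-drop : ∀ {R x} pre {u x′ ρ} → Tail R x (pre ++ (u , x′) ∷ ρ) → u ∈ S × swap one x′ u ≡ true × Tail R x′ ρ
  tail-drop []        (step _ u∈S (_ , ux′) τ) = u∈S , ux′ , τ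
  tail-drop (_ ∷ pre) (step _ _ _ τ)           = tail-drop pre τ

  -- ρ is the part of `whole` still to be scanned for u. The implication between the two `All`
  -- records that u is absent from the part already scanned.
  cut-tail : ∀ {R x u x′ y} whole ρ → Tail R x ((u , x′) ∷ whole) → Unique (map proj₁ whole) →
             (All (u ≢_) (map proj₁ ρ) → All (u ≢_) (map proj₁ whole)) → Tail R y ρ → Unique (map proj₁ ρ) →
             Tail R x (cut u ((u , x′) ∷ whole) ρ) × Unique (map proj₁ (cut u ((u , x′) ∷ whole) ρ))
  cut-tail whole [] τ uniq fresh τ′ uniq′ = τ , fresh [] ∷ uniq
  cut-tail {u = u} whole ((u′ , _) ∷ ρ) τ@(step x∉S _ (xu , _) _) uniq fresh (step _ u∈S (_ , ux′) τ′) (u≢ ∷ uniq′)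
    with u Fin.≟ u′
  ... | yes refl = step x∉S u∈S (xu , ux′) τ′ , u≢ ∷ uniq′
  ... | no  u≢u′ = cut-tail whole ρ τ uniq (fresh ∘ (u≢u′ ∷_)) τ′ uniq′

  dedupe-tail : ∀ {R x ρ} → Tail R x ρ → Tail R x (dedupe ρ) × Unique (map proj₁ (dedupe ρ))
  dedupe-tail (stop x∉S r) = stop x∉S r , []
  dedupe-tail {ρ = _ ∷ ρ} (step x∉S u∈S edges τ) =
    let τ′ , uniq = dedupe-tail τ in cut-tail (dedupe ρ) (dedupe ρ) (step x∉S u∈S edges τ′) uniq id τ′ uniq

  -- How the current x hangs on the stack: either s leads to it, or its earliest predecessor is on
  -- top, so no older pair has an edge to x.
  data Top : List (Fin n × Fin n) → Fin n → Set where
    source : ∀ {x} → x ∈ₗ sources → Top [] x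
    from   : ∀ {x y u σ} → x ∉ₗ sources → swap one x u ≡ true → All (λ (_ , u′) → swap one x u′ ≡ false) σ →
             Top ((y , u) ∷ σ) x

  -- Every older x′ has chosen its farthest successor and therefore has no edge to the newer u. With
  -- `Top`, this rules out all chords within the stack.
  data Stack : List (Fin n × Fin n) → Set where
    []  : Stack []
    push : ∀ {x u σ} → x ∉ S → u ∈ S → x ∉ₗ targets → swap two x u ≡ true → Top σ x →
           All (λ (x′ , _) → swap two x′ u ≡ false) σ → Stack σ → Stack ((x , u) ∷ σ)

  stack-∈ : ∀ {σ} → Stack σ → All (λ (_ , u) → u ∈ S) σ
  stack-∈ []                        = []
  stack-∈ (push _ u∈S _ _ _ _ stack) = u∈S ∷ stack-∈ stack

  stack-∉ : ∀ {σ} → Stack σ → All (λ (x , _) → x ∉ S) σ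
  stack-∉ []                        = []
  stack-∉ (push x∉S _ _ _ _ _ stack) = x∉S ∷ stack-∉ stack

  stack-∉targets : ∀ {σ} → Stack σ → All (λ (x , _) → x ∉ₗ targets) σ
  stack-∉targets []                        = []
  stack-∉targets (push _ _ x∉T _ _ _ stack) = x∉T ∷ stack-∉targets stack

  stack-suffix : ∀ pre {σ} → Stack (pre ++ σ) → Stack σ
  stack-suffix []        stack                     = stack
  stack-suffix (_ ∷ pre) (push _ _ _ _ _ _ stack) = stack-suffix pre stack

  ¬E-out : ∀ {x y} → x ∉ S → y ∉ S → ¬ E (v x) (v y)
  ¬E-out x∉S y∉S (in→out x∈S _ _) = x∉S x∈S
  ¬E-out x∉S y∉S (out→in _ y∈S _) = y∉S y∈S

  ¬E-in : ∀ {u y} → u ∈ S → y ∈ S → ¬ E (v u) (v y)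
  ¬E-in u∈S y∈S (in→out _ y∉S _) = y∉S y∈S
  ¬E-in u∈S y∈S (out→in u∉S _ _) = u∉S u∈S

  ¬E-in→out : ∀ {u x} → x ∉ S → swap one x u ≡ false → ¬ E (v u) (v x)
  ¬E-in→out x∉S miss (in→out _ _ hit)  = false≢true (trans (sym miss) hit)
  ¬E-in→out x∉S miss (out→in _ x∈S _) = x∉S x∈S

  ¬E-out→in : ∀ {x u} → u ∈ S → swap two x u ≡ false → ¬ E (v x) (v u)
  ¬E-out→in u∈S miss (in→out _ u∉S _)  = u∉S u∈S
  ¬E-out→in u∈S miss (out→in _ _ hit) = false≢true (trans (sym miss) hit)

  -- c may stand behind the stack without closing a chord from s or from a vertex of the stack.
  Blocked : List (Fin n × Fin n) → Vtx n → Set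
  Blocked σ c = ¬ E s c × All (λ (x , u) → ¬ E (v x) c × ¬ E (v u) c) σ

  -- Unwinds the stack one pair at a time. The new skips to exclude start at x′ or u and are ruled
  -- out by `Blocked`. That u and x are blocked for the remaining stack is what `push` and `from`
  -- record.
  build-augmenting : ∀ σ x p → Stack σ → Top σ x → x ∉ S → All (Blocked σ) p →
    EndsAt t (v x ∷ p) → Walk E (v x ∷ p) → NoSkip (v x ∷ p) → IsAugmentingPath I₁ I₂ S (build σ x p)
  build-augmenting [] x p stack (source x∈s) x∉S blocked end walk noskip =
    NoSkip⇒augmenting (v x ∷ p) end (s→ x∉S (Table.sound src x∈s) , walk) (All.map proj₁ blocked , noskip)
  build-augmenting ((x′ , u) ∷ σ) x p (push x′∉S u∈S x′∉T x′u top skip stack) (from x∉s ux skip′) x∉S blocked end walk noskip =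
    build-augmenting σ x′ (v u ∷ v x ∷ p) stack top x′∉S
      (blocked-u ∷ blocked-x ∷ All.map (λ { (¬s , _ ∷ ¬σ) → ¬s , ¬σ }) blocked)
      end (out→in x′∉S u∈S x′u , in→out u∈S x∉S ux , walk)
      (¬E-out x′∉S x∉S ∷ All.map (λ { (_ , (¬x′ , _) ∷ _) → ¬x′ }) blocked ,
       All.map (λ { (_ , (_ , ¬u) ∷ _) → ¬u }) blocked , noskip)
    where
    blocked-u : Blocked σ (v u)
    blocked-u = (λ { (s→ u∉S _) → u∉S u∈S }) ,
      All.zipWith (λ (miss , u′∈S) → ¬E-out→in u∈S miss , ¬E-in u′∈S u∈S) (skip , stack-∈ stack)
    blocked-x : Blocked σ (v x)
    blocked-x = (λ { (s→ _ indep) → x∉s (Table.complete src indep) }) ,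
      All.zipWith (λ (miss , x″∉S) → ¬E-out x″∉S x∉S , ¬E-in→out x∉S miss) (skip′ , stack-∉ stack)

  build-target : ∀ {σ x} → Stack σ → Top σ x → x ∉ S → x ∈ₗ targets → IsAugmentingPath I₁ I₂ S (build σ x (t ∷ []))
  build-target {σ} {x} stack top x∉S x∈T = build-augmenting σ x (t ∷ []) stack top x∉S
    (((λ ()) , All.zipWith (λ (u∈S , x∉T) → (λ { (→t _ indep) → x∉T (Table.complete tgt indep) }) , (λ { (→t u∉S _) → u∉S u∈S }))
                 (stack-∈ stack , stack-∉targets stack)) ∷ [])
    refl (→t x∉S (Table.sound tgt x∈T) , tt) ([] , tt)

  -- The price of one `findLast`, used as the unit of account.
  cost : ℕ
  cost = suc (depth S)

  Good : ℕ → OracleAlg n (List (Vtx n)) → Set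
  Good c m = IsAugmentingPath I₁ I₂ S (output I₁ I₂ m) × queries I₁ I₂ m ≤ c

  Good->>= : ∀ {A : Set} {c d} (m : OracleAlg n A) k → queries I₁ I₂ m ≤ c → Good d (k (output I₁ I₂ m)) → Good (c + d) (m >>= k)
  Good->>= m k c≤ (good , d≤) rewrite output->>= I₁ I₂ m k | queries->>= I₁ I₂ m k = good , +-mono-≤ c≤ d≤

  -- No x′ on the stack has an edge into the remaining tail, because each one took its farthest
  -- successor. A round consists of two searches and removes at least one pair from ρ.
  shorten-spec : ∀ f σ x ρ → Stack σ → Top σ x → Tail (_∈ₗ targets) x ρ →
    All (λ (x′ , _) → All (λ (u , _) → swap two x′ u ≡ false) ρ) σ →
    length ρ ≤ f → length σ + length ρ ≤ ∣ S ∣ → Good (f * (cost + cost)) (shorten S sources targets f σ x ρ)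
  advance-spec : ∀ f σ x ρ d → Stack σ → Top σ x → Tail (_∈ₗ targets) x ρ →
    All (λ (x′ , _) → All (λ (u , _) → swap two x′ u ≡ false) ρ) σ →
    length ρ ≤ f → length σ + length ρ ≤ ∣ S ∣ → Good (f * (cost + cost)) (advance S sources targets {x} f σ ρ d)
  jump-spec : ∀ f σ x ρ → x ∉ₗ targets → Stack σ → Top σ x → Tail (_∈ₗ targets) x ρ →
    All (λ (x′ , _) → All (λ (u , _) → swap two x′ u ≡ false) ρ) σ →
    length ρ ≤ suc f → length σ + length ρ ≤ ∣ S ∣ → ∀ r → Last (swap two x ∘ proj₁) ρ r →
    Good (cost + f * (cost + cost)) (jump S sources targets f σ x r)
  retreat-spec : ∀ f y u σ x ρ d → Stack ((y , u) ∷ σ) → swap one x u ≡ true → Tail (_∈ₗ targets) x ρ →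
    All (λ (x′ , _) → All (λ (u , _) → swap two x′ u ≡ false) ρ) ((y , u) ∷ σ) →
    length ρ ≤ f → suc (length σ + length ρ) ≤ ∣ S ∣ →
    Good (cost + f * (cost + cost)) (retreat S sources targets {x} f ((y , u) ∷ σ) ρ d)

  shorten-spec f σ x ρ = λ stack top τ → advance-spec f σ x ρ (x ∈?ₗ targets) stack top τ

  advance-spec zero σ x [] d stack top (stop x∉S x∈T) fresh len size = build-target stack top x∉S x∈T , z≤n
  advance-spec (suc f) σ x ρ (yes x∈T) stack top τ fresh len size = build-target stack top (tail-∉ τ) x∈T , z≤n
  advance-spec (suc f) σ x ρ (no  x∉T) stack top τ fresh len size =
    let last , q = findLast-spec two (tail-∉ τ) proj₁ ρ (tail-∈ τ) (ℕ.m+n≤o⇒n≤o (length σ) size)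
        good , q′ = Good->>= (findLast S two x proj₁ ρ) (jump S sources targets f σ x) q
                      (jump-spec f σ x ρ x∉T stack top τ fresh len size _ last)
    in good , ≤-trans q′ (≤-reflexive (sym (ℕ.+-assoc cost cost _)))

  -- The first pair of the tail starts with a successor of x, and an empty tail would make x a
  -- target.
  jump-spec f σ x ρ x∉T stack top τ fresh len size _ (none misses) = contradiction misses (¬all-miss τ)
    where
    ¬all-miss : ∀ {ρ} → Tail (_∈ₗ targets) x ρ → ¬ All (λ (u , _) → swap two x u ≡ false) ρ
    ¬all-miss (stop _ x∈T)           _          = x∉T x∈T
    ¬all-miss (step _ _ (xu , _) _) (miss ∷ _) = false≢true (trans (sym miss) xu)
  jump-spec f σ x ρ x∉T stack top τ fresh len size _ (some {pre} {u , x′} {ρ′} refl xu miss) =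
    let u∈S , ux′ , τ′ = tail-drop pre τ
        shorter = ≤-trans (ℕ.m≤n+m (suc (length ρ′)) (length pre)) (≤-reflexive (sym (List.length-++ pre)))
    in retreat-spec f x u σ x′ ρ′ (x′ ∈?ₗ sources)
         (push (tail-∉ τ) u∈S x∉T xu top (All.map (λ fr → All.head (All.++⁻ʳ pre fr)) fresh) stack) ux′ τ′
         (miss ∷ All.map (λ fr → All.tail (All.++⁻ʳ pre fr)) fresh)
         (ℕ.≤-pred (≤-trans shorter len))
         (≤-trans (≤-reflexive (sym (ℕ.+-suc (length σ) _))) (≤-trans (ℕ.+-monoʳ-≤ (length σ) shorter) size))

  retreat-spec f y u σ x ρ (yes x∈s) stack ux τ fresh len size =
    map₂ (λ q → ≤-trans q (ℕ.m≤n+m _ cost))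
      (shorten-spec f [] x ρ [] (source x∈s) τ [] len (≤-trans (ℕ.m≤n+m _ (suc (length σ))) size))
  retreat-spec f y u σ x ρ (no x∉s) stack ux τ fresh len size =
    let last , q = findLast-spec one (tail-∉ τ) proj₂ ((y , u) ∷ σ) (stack-∈ stack) (ℕ.m+n≤o⇒m≤o (suc (length σ)) size)
    in Good->>= (findLast S one x proj₂ ((y , u) ∷ σ)) (pop S sources targets f x ρ) q (pop-spec _ last)
    where
    pop-spec : ∀ r → Last (swap one x ∘ proj₂) ((y , u) ∷ σ) r → Good (f * (cost + cost)) (pop S sources targets f x ρ r)
    -- The pair just pushed ends in a predecessor of x, so the search cannot fail.
    pop-spec _ (none (miss ∷ _)) = contradiction (trans (sym miss) ux) false≢true
    pop-spec _ (some {pre} {a} {σ′} eq ux miss) = shorten-spec f (a ∷ σ′) x ρ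
      (stack-suffix pre (subst Stack eq stack)) (from x∉s ux miss) τ (All.++⁻ʳ pre (subst (All _) eq fresh)) len
      (≤-trans (ℕ.+-monoˡ-≤ (length ρ) (≤-trans (ℕ.m≤n+m (suc (length σ′)) (length pre))
        (≤-reflexive (sym (trans (cong length eq) (List.length-++ pre)))))) size)

  data Reach : List (Fin n × Fin n) → Fin n → Set where
    start : ∀ {x} → x ∉ S → x ∈ₗ sources → Reach [] x
    step  : ∀ {x y u σ} → x ∉ S → u ∈ S → swap two y u ≡ true × swap one x u ≡ true → Reach σ y → Reach ((y , u) ∷ σ) x

  reach-∉ : ∀ {σ x} → Reach σ x → x ∉ S
  reach-∉ (start x∉S _)    = x∉S
  reach-∉ (step x∉S _ _ _) = x∉S

  forward-tail : ∀ {R σ x ρ} → Reach σ x → Tail R x ρ →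
                 proj₁ (forward σ x ρ) ∈ₗ sources × Tail R (proj₁ (forward σ x ρ)) (proj₂ (forward σ x ρ))
  forward-tail (start _ x∈s)          τ = x∈s , τ
  forward-tail (step _ u∈S edges walk) τ = forward-tail walk (step (reach-∉ walk) u∈S edges τ)

  -- After `dedupe` at most r pairs are left, so r rounds of two searches suffice.
  augment-spec : ∀ {σ w} → Reach σ w → w ∈ₗ targets → Good (∣ S ∣ * (cost + cost)) (augment S sources targets σ w)
  augment-spec {σ} {w} walk w∈T =
    let x∈s , τ = forward-tail walk (stop (reach-∉ walk) w∈T)
        τ′ , uniq = dedupe-tail τ
        ρ = dedupe (proj₂ (forward σ w []))
        len = ≤-trans (≤-reflexive (sym (List.length-map proj₁ ρ))) (unique⇒length≤ S uniq (All.map⁺ (tail-∈ τ′)))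
        good , q = shorten-spec (length ρ) [] _ ρ [] (source x∈s) τ′ [] ≤-refl len
    in good , ≤-trans q (ℕ.*-monoˡ-≤ (cost + cost) len)

-- Backward search

-- For u ∈ S with seen u, via u = (σ , x) is a walk from s to x followed by the edge x → u. Entries of
-- found are never removed, so at most β per column bounds how many ever become useless. An edge x → u
-- found only when x turns light is in rest x instead, where it does not count towards β.
record State (n : ℕ) : Set where
  constructor state
  field
    seen  : Fin n → Bool
    via   : Fin n → List (Fin n × Fin n) × Fin n
    found : Fin n → Fin n → Bool
    light : Fin n → Bool
    rest  : Fin n → List (Fin n)

  fresh : Fin n → Fin n → Bool
  fresh x u = found x u ∧ not (seen u)

members : ∀ {n} → Subset n → (Fin n → Bool) → List (Fin n)
members S p = elements (λ u → lookup S u ∧ p u)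

∧-true⁻ : ∀ {a b} → a ∧ b ≡ true → a ≡ true × b ≡ true
∧-true⁻ {true} refl = refl , refl

∧-true⁺ : ∀ {a b} → a ≡ true → b ≡ true → a ∧ b ≡ true
∧-true⁺ refl refl = refl

not-true⁻ : ∀ {a} → not a ≡ true → a ≡ false
not-true⁻ {false} _ = refl

not-true⁺ : ∀ {a} → a ≡ false → not a ≡ true
not-true⁺ refl = refl

∈-members⁺ : ∀ {n} {S : Subset n} {p u} → u ∈ S → p u ≡ true → u ∈ₗ members S p
∈-members⁺ u∈S pu = ∈-elements⁺ (∧-true⁺ ([]=⇒lookup u∈S) pu)

∈-members⁻ : ∀ {n} {S : Subset n} {p u} → u ∈ₗ members S p → u ∈ S × p u ≡ true
∈-members⁻ u∈ = let Su , pu = ∧-true⁻ (∈-elements⁻ u∈) in lookup⇒[]= _ _ Su , pu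

members-∈ : ∀ {n} (S : Subset n) p → All (_∈ S) (members S p)
members-∈ S p = All.tabulate (λ u∈ → proj₁ (∈-members⁻ {p = p} u∈))

length-members : ∀ {n} (S : Subset n) p → length (members S p) ≤ ∣ S ∣
length-members S p = ≤-trans (≤-reflexive (length-elements (λ u → lookup S u ∧ p u))) (#-⊆ (λ u eq → lookup⇒[]= u S (proj₁ (∧-true⁻ eq))))

continue : ∀ {n} → List (Fin n × Fin n) → Fin n → List (Fin n × Fin n) → List (Fin n × Fin n) × Fin n
continue σ x []            = σ , x
continue σ x ((u , y) ∷ ρ) = continue ((x , u) ∷ σ) y ρ

-- For a marked u in S, the x with an edge u → x through which u was marked, and the tail from x to
-- a root. Read only at such u.
Tails : ℕ → Set
Tails n = Fin n → Fin n × List (Fin n × Fin n)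

module _ {n : ℕ} (S : Subset n) (sources targets : List (Fin n)) (st : State n) where
  open State st

  Root : Fin n → Set
  Root x = x ∈ₗ targets ⊎ light x ≡ false

  Known : Fin n → Fin n → Set
  Known x u = light x ≡ true × (found x u ≡ true ⊎ u ∈ₗ rest x)

  Next : (Fin n → Bool) → Fin n → Set
  Next marks x = x ∉ S × marks x ≡ false × (Root x ⊎ ∃ λ u → u ∈ S × marks u ≡ true × Known x u)

  next? : ∀ marks → Dec (∃ (Next marks))
  next? marks = Fin.any? λ x → ¬? (x ∈? S) ×-dec (marks x Bool.≟ false) ×-dec
    (((x ∈?ₗ targets) ⊎-dec (light x Bool.≟ false)) ⊎-dec
     Fin.any? λ u → (u ∈? S) ×-dec (marks u Bool.≟ true) ×-dec
       (light x Bool.≟ true) ×-dec ((found x u Bool.≟ true) ⊎-dec (u ∈?ₗ rest x)))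

  tail : ∀ {marks x} → Tails n → Next marks x → List (Fin n × Fin n)
  tail tails (_ , _ , inj₁ _)       = []
  tail tails (_ , _ , inj₂ (u , _)) = (u , proj₁ (tails u)) ∷ proj₂ (tails u)

  -- Every round marks one vertex: a new predecessor u in S of the chosen x, or x itself once it has
  -- none. In the first case x may be chosen again, so n rounds with one `findLast` each suffice.
  search  : ℕ → (Fin n → Bool) → Tails n → OracleAlg n (Maybe (List (Fin n × Fin n) × Fin n))
  explore : ℕ → (marks : Fin n → Bool) → Tails n → Dec (∃ (Next marks)) → OracleAlg n (Maybe (List (Fin n × Fin n) × Fin n))
  enter   : ∀ {x} → ℕ → (Fin n → Bool) → Tails n → List (Fin n × Fin n) → Dec (x ∈ₗ sources) →
            OracleAlg n (Maybe (List (Fin n × Fin n) × Fin n))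
  visit   : ℕ → (Fin n → Bool) → Tails n → Fin n → List (Fin n × Fin n) → Maybe (Fin n × List (Fin n)) →
            OracleAlg n (Maybe (List (Fin n × Fin n) × Fin n))

  -- With n units of fuel at the start, every vertex is marked by now, and nothing is left to
  -- explore.
  search zero    marks tails = ret nothing
  search (suc f) marks tails = explore f marks tails (next? marks)

  explore f marks tails (no  _)          = ret nothing
  explore f marks tails (yes (x , next)) = enter f marks tails (tail tails next) (x ∈?ₗ sources)

  enter {x} f marks tails ρ (yes _) = ret (just (continue [] x ρ))
  enter {x} f marks tails ρ (no  _) = findLast S one x id (members S (not ∘ marks)) >>= visit f marks tails x ρ

  visit f marks tails x ρ nothing        = search f (marks [ x ≔ true ]) tails
  visit f marks tails x ρ (just (u , _)) =
    -- The recorded walk to u, the edge u → x and the tail from x together lead from s to a root.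
    if seen u then ret (just (continue ((proj₂ (via u) , u) ∷ proj₁ (via u)) x ρ))
              else search f (marks [ u ≔ true ]) (tails [ u ≔ (x , ρ) ])

-- Correctness and cost of the backward search

module Search {n : ℕ} {I₁ I₂ : Subset n → Bool} (mat₁ : IsMatroid I₁) (mat₂ : IsMatroid I₂)
              {S : Subset n} (common : CommonIndep I₁ I₂ S)
              {sources targets : List (Fin n)} (src : Table I₁ S sources) (tgt : Table I₂ S targets) where

  open FindLast mat₁ mat₂ common
  open Shorten mat₁ mat₂ common src tgt

  record Sound (st : State n) : Set where
    open State st
    field
      seen-sound  : ∀ {u} → seen u ≡ true → u ∈ S × swap two (proj₂ (via u)) u ≡ true × Reach (proj₁ (via u)) (proj₂ (via u))
      found-sound : ∀ {x u} → found x u ≡ true → x ∉ S × u ∈ S × swap two x u ≡ true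
      rest-sound  : ∀ {x u} → light x ≡ true → u ∈ₗ rest x → swap two x u ≡ true
      light-complete : ∀ {x u} → light x ≡ true → u ∈ S → seen u ≡ false → swap two x u ≡ true →
                       found x u ≡ true ⊎ u ∈ₗ rest x

  module _ {st : State n} (sound : Sound st) where
    open State st
    open Sound sound

    private
      Root′ : Fin n → Set
      Root′ = Root S sources targets st

      Next′ : (Fin n → Bool) → Fin n → Set
      Next′ = Next S sources targets st

    record Explored (f : ℕ) (marks : Fin n → Bool) (tails : Tails n) : Set where
      field
        fuel     : n ≤ # marks + f
        marked-in   : ∀ {u} → u ∈ S → marks u ≡ true →
                   seen u ≡ false × swap one (proj₁ (tails u)) u ≡ true × Tail Root′ (proj₁ (tails u)) (proj₂ (tails u))
        marked-out  : ∀ {x} → x ∉ S → marks x ≡ true →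
                   x ∉ₗ sources × (∀ u → u ∈ S → marks u ≡ false → swap one x u ≡ false)

    Found : Maybe (List (Fin n × Fin n) × Fin n) → Set
    Found nothing        = IsMaxCommonIndep I₁ I₂ S
    Found (just (σ , w)) = Reach σ w × Root′ w

    known-sound : ∀ {x u} → Known S sources targets st x u → swap two x u ≡ true
    known-sound (_ , inj₁ xu)          = proj₂ (proj₂ (found-sound xu))
    known-sound (light-x , inj₂ u∈rest) = rest-sound light-x u∈rest

    continue-found : ∀ {σ x ρ} → Reach σ x → Tail Root′ x ρ → Found (just (continue σ x ρ))
    continue-found walk (stop _ root)         = walk , root
    continue-found walk (step _ u∈S edges τ) = continue-found (step (tail-∉ τ) u∈S edges walk) τ

    -- Translates missing edges into the spanning condition of the certificate. Let B consist of the
    -- elements of S satisfying p. If S ∩ W plus x were independent, so would be S minus B plus x,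
    -- which gives a swap with some u in B, or independence of S + x when B is empty.
    unswappable : ∀ w W (p : Fin n → Bool) {x} → x ∉ S → (∀ {u} → u ∈ S → p u ≡ false → u ∈ W) →
      I w (S ∪ ⁅ x ⁆) ≢ true → (∀ {u} → u ∈ S → p u ≡ true → swap w x u ≢ true) → I w ((S ∩ W) ∪ ⁅ x ⁆) ≢ true
    unswappable w W p {x} x∉S outside-p dep no-swap indep with members S p in eq
      | down (mat w) (∪⁅⁆-mono {p = S ∖ members S p} {S ∩ W} {x} λ u∈ → let u∈S , u∉B = ∈-∖⁻ S (members S p) u∈ in
          Subset.x∈p∩q⁺ (u∈S , outside-p u∈S (≢true (u∉B ∘ ∈-members⁺ u∈S)))) indep
    ... | []    | indep′ = dep indep′
    ... | b ∷ B | indep′ =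
      let u , u∈B , sw = ∖-indep⇒swap (mat w) (I-S w) x∉S (here (proj₁ (∈-members⁻ {p = p} (subst (b ∈ₗ_) (sym eq) (here refl))))) indep′
          u∈S , pu = ∈-members⁻ {p = p} (subst (u ∈ₗ_) (sym eq) u∈B)
      in no-swap u∈S pu sw

    -- W is the set of marked vertices. An x in W outside S has no edge from s or from an unmarked
    -- element of S. An x outside both has no edge to t or to a marked u: it would be eligible as a
    -- root or, being light, through a recorded edge, since marked elements of S are unseen and
    -- `light-complete` applies.
    closed⇒maximum : ∀ {f marks tails} → Explored f marks tails → (∀ x → ¬ Next′ marks x) → IsMaxCommonIndep I₁ I₂ S
    closed⇒maximum {marks = marks} explored closed = maximum-certificate mat₁ mat₂ common W
      (λ x x∈W x∉S → let x∉s , no-swap = marked-out x∉S (W-true x∈W) in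
        unswappable one W (not ∘ marks) x∉S (λ _ → true-W ∘ λ eq → trans (sym (Bool.not-involutive _)) (cong not eq))
          (x∉s ∘ Table.complete src)
          (λ u∈S mu sw → false≢true (trans (sym (no-swap _ u∈S (not-true⁻ mu))) sw)))
      (λ x x∈∁W x∉S → let mx = W-false x∈∁W in
        unswappable two (∁ W) marks x∉S (λ _ → false-W)
          (λ indep → closed x (x∉S , mx , inj₁ (inj₁ (Table.complete tgt indep))))
          (λ {u} u∈S mu sw → closed x (x∉S , mx , reachable u∈S mu sw)))
      where
      open Explored explored
      W : Subset n
      W = Vec.tabulate marks
      W-true : ∀ {x} → x ∈ W → marks x ≡ true
      W-true {x} x∈W = trans (sym (lookup∘tabulate marks x)) ([]=⇒lookup x∈W)
      true-W : ∀ {x} → marks x ≡ true → x ∈ W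
      true-W {x} mx = lookup⇒[]= x W (trans (lookup∘tabulate marks x) mx)
      W-false : ∀ {x} → x ∈ ∁ W → marks x ≡ false
      W-false x∈∁W = ≢true (λ mx → Subset.x∈∁p⇒x∉p x∈∁W (true-W mx))
      false-W : ∀ {x} → marks x ≡ false → x ∈ ∁ W
      false-W mx = Subset.x∉p⇒x∈∁p (λ x∈W → false≢true (trans (sym mx) (W-true x∈W)))
      reachable : ∀ {x u} → u ∈ S → marks u ≡ true → swap two x u ≡ true →
                  Root′ x ⊎ ∃ λ u → u ∈ S × marks u ≡ true × Known S sources targets st x u
      reachable {x} u∈S mu sw with light x in light-x
      ... | false = inj₁ (inj₂ refl)
      ... | true  = inj₂ (_ , u∈S , mu , refl , light-complete light-x u∈S (proj₁ (marked-in u∈S mu)) sw)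

    Finds : ℕ → OracleAlg n (Maybe (List (Fin n × Fin n) × Fin n)) → Set
    Finds c m = Found (output I₁ I₂ m) × queries I₁ I₂ m ≤ c

    search-spec : ∀ f marks tails → Explored f marks tails → Finds (f * cost) (search S sources targets st f marks tails)
    explore-spec : ∀ f marks tails → Explored (suc f) marks tails → ∀ d → Finds (suc f * cost) (explore S sources targets st f marks tails d)
    enter-spec : ∀ f marks tails x ρ → Explored (suc f) marks tails → x ∉ S → marks x ≡ false → Tail Root′ x ρ → ∀ d →
                 Finds (suc f * cost) (enter S sources targets st {x} f marks tails ρ d)
    visit-spec : ∀ f marks tails x ρ → Explored (suc f) marks tails → x ∉ S → marks x ≡ false → Tail Root′ x ρ → x ∉ₗ sources →
                 ∀ r → Last (swap one x) (members S (not ∘ marks)) r → Finds (f * cost) (visit S sources targets st f marks tails x ρ r)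

    search-spec zero marks tails explored = closed⇒maximum explored (λ x (_ , mx , _) → #-full (≤-trans (Explored.fuel explored) (≤-reflexive (ℕ.+-identityʳ _))) x mx) , z≤n
    search-spec (suc f) marks tails explored = explore-spec f marks tails explored (next? S sources targets st marks)

    explore-spec f marks tails explored (no  closed) = closed⇒maximum explored (λ x next → closed (x , next)) , z≤n
    explore-spec f marks tails explored (yes (x , x∉S , mx , inj₁ root)) =
      enter-spec f marks tails x _ explored x∉S mx (stop x∉S root) (x ∈?ₗ sources)
    explore-spec f marks tails explored (yes (x , x∉S , mx , inj₂ (u , u∈S , mu , known))) =
      let _ , uy , τ = Explored.marked-in explored u∈S mu in
      enter-spec f marks tails x _ explored x∉S mx (step x∉S u∈S (known-sound known , uy) τ) (x ∈?ₗ sources)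

    enter-spec f marks tails x ρ explored x∉S mx τ (yes x∈s) = continue-found (start x∉S x∈s) τ , z≤n
    enter-spec f marks tails x ρ explored x∉S mx τ (no  x∉s)
      with findLast-spec one x∉S id (members S (not ∘ marks)) (members-∈ S _) (length-members S _)
    ... | last , q
      rewrite output->>= I₁ I₂ (findLast S one x id (members S (not ∘ marks))) (visit S sources targets st f marks tails x ρ)
            | queries->>= I₁ I₂ (findLast S one x id (members S (not ∘ marks))) (visit S sources targets st f marks tails x ρ)
      = let found , q′ = visit-spec f marks tails x ρ explored x∉S mx τ x∉s _ last in found , +-mono-≤ q q′

    visit-spec f marks tails x ρ explored x∉S mx τ x∉s _ (none misses) = search-spec f (marks [ x ≔ true ]) tails record
      { fuel    = ≤-trans fuel (≤-trans (≤-reflexive (ℕ.+-suc _ f)) (ℕ.+-monoˡ-≤ f (#-mono-< (λ _ → ≔-true marks x) x mx (≔-same marks x true))))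
      ; marked-in  = λ {u} u∈S mu → case ≔-true⁻ marks x mu of λ
          { (inj₁ refl) → contradiction u∈S x∉S ; (inj₂ mu) → marked-in u∈S mu }
      ; marked-out = λ {y} y∉S my → case ≔-true⁻ marks x my of λ
          { (inj₁ refl) → x∉s , λ u u∈S mu → All.lookup misses (∈-members⁺ u∈S (not-true⁺ (proj₂ (≔-false⁻ marks x mu))))
          ; (inj₂ my)   → map₂ (λ no-swap u u∈S mu → no-swap u u∈S (proj₂ (≔-false⁻ marks x mu))) (marked-out y∉S my) }
      }
      where open Explored explored
    visit-spec f marks tails x ρ explored x∉S mx τ x∉s _ (some {pre} {u} eq ux _)
      with ∈-members⁻ {p = not ∘ marks} (subst (u ∈ₗ_) (sym eq) (∈-++⁺ʳ pre (here refl))) | seen u in seen-u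
    ... | u∈S , _  | true  = let _ , yu , walk = seen-sound seen-u in continue-found (step x∉S u∈S (yu , ux) walk) τ , z≤n
    ... | u∈S , mu | false = search-spec f (marks [ u ≔ true ]) (tails [ u ≔ (x , ρ) ]) record
      { fuel    = ≤-trans fuel (≤-trans (≤-reflexive (ℕ.+-suc _ f)) (ℕ.+-monoˡ-≤ f (#-mono-< (λ _ → ≔-true marks u) u (not-true⁻ mu) (≔-same marks u true))))
      ; marked-in  = marked-in′
      ; marked-out = λ {y} y∉S my → case ≔-true⁻ marks u my of λ
          { (inj₁ refl) → contradiction u∈S y∉S
          ; (inj₂ my)   → map₂ (λ no-swap u′ u′∈S mu′ → no-swap u′ u′∈S (proj₂ (≔-false⁻ marks u mu′))) (marked-out y∉S my) }
      }
      where
      open Explored explored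
      tails′ = tails [ u ≔ (x , ρ) ]
      marked-in′ : ∀ {u′} → u′ ∈ S → (marks [ u ≔ true ]) u′ ≡ true →
        seen u′ ≡ false × swap one (proj₁ (tails′ u′)) u′ ≡ true × Tail Root′ (proj₁ (tails′ u′)) (proj₂ (tails′ u′))
      marked-in′ {u′} u′∈S mu′ with u′ Fin.≟ u
      ... | yes refl = seen-u , ux , τ
      ... | no  _    = marked-in u′∈S mu′

-- Classification into light and heavy elements

does-true⁻ : ∀ {P : Set} (d : Dec P) → does d ≡ true → P
does-true⁻ (yes p) _ = p

does-false⁻ : ∀ {P : Set} (d : Dec P) → does d ≡ false → ¬ P
does-false⁻ (no ¬p) _ = ¬p

module _ {n : ℕ} (S : Subset n) (h β : ℕ) where
  open State

  row : State n → Fin n → ℕ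
  row st x = # (fresh st x)

  col : State n → Fin n → ℕ
  col st u = # (λ x → found st x u)

  -- Full columns are left out so that no column exceeds β, which limits the entries that become
  -- useless when u is seen.
  available : State n → Fin n → Fin n → Bool
  available st x u = not (seen st u) ∧ (not (found st x u) ∧ does (col st u <? β))

  popular : State n → Fin n → Bool
  popular st u = not (seen st u) ∧ not (does (col st u <? β))

  add : State n → Fin n → Fin n → State n
  add st x u = record st { found = λ y z → found st y z ∨ (does (y Fin.≟ x) ∧ does (z Fin.≟ u)) }

  lighten : State n → Fin n → List (Fin n) → State n
  lighten st x us = record st { light = light st [ x ≔ true ] ; rest = rest st [ x ≔ us ] }

  refresh : ℕ → Fin n → State n → OracleAlg n (State n)
  extend  : ℕ → Fin n → State n → Maybe (Fin n × List (Fin n)) → OracleAlg n (State n)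

  refresh zero    x st = ret st
  refresh (suc f) x st = if light st x then ret st else (findLast S two x id (members S (available st x)) >>= extend f x st)

  extend f x st (just (u , _)) = refresh f x (add st x u)
  -- Every unseen partner of x is by now found or popular, so testing the popular elements one by
  -- one makes the record of x complete.
  extend f x st nothing        =
    filterAsk two (λ u → (S - u) ∪ ⁅ x ⁆) (members S (popular st)) >>= λ us → ret (lighten st x us)

  refreshAll : List (Fin n) → State n → OracleAlg n (State n)
  refreshAll []       st = ret st
  refreshAll (x ∷ xs) st = refresh (h ∸ row st x) x st >>= refreshAll xs

  record Bounded (st : State n) : Set where
    field
      row-≤ : ∀ x → row st x ≤ h
      col-≤ : ∀ u → col st u ≤ β

  Ready : State n → Fin n → Set
  Ready st x = light st x ≡ true ⊎ h ≤ row st x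

  -- Double counting: a popular element is unseen and has at least β entries, all of them fresh,
  -- while the n rows hold at most h fresh entries each.
  popular-count : ∀ {st} → Bounded st → ∀ p → 0 < β → n * h ≤ p * β → length (members S (popular st)) ≤ p
  popular-count {st} bounded p (s≤s _) nh≤pβ = ℕ.*-cancelʳ-≤ _ p β (begin
    length (members S (popular st)) * β   ≡⟨ cong (_* β) (length-elements q) ⟩
    # q * β                               ≡⟨ sum-*ʳ (⟦_⟧ ∘ q) β ⟨
    sum (λ u → ⟦ q u ⟧ * β)               ≤⟨ sum-mono column ⟩
    sum (λ u → # (λ x → fresh st x u))    ≡⟨ ∑-comm (λ u x → ⟦ fresh st x u ⟧) ⟩
    sum (row st)                          ≤⟨ sum-bounded h (Bounded.row-≤ bounded) ⟩
    n * h                                 ≤⟨ nh≤pβ ⟩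
    p * β                                 ∎)
    where
    open ≤-Reasoning
    q : Fin n → Bool
    q u = lookup S u ∧ popular st u
    column : ∀ u → ⟦ q u ⟧ * β ≤ # (λ x → fresh st x u)
    column u with lookup S u | seen st u | does (col st u <? β) in above
    ... | false | _     | _     = z≤n
    ... | true  | true  | _     = z≤n
    ... | true  | false | true  = z≤n
    ... | true  | false | false = ≤-trans (≤-reflexive (ℕ.*-identityˡ β))
      (≤-trans (ℕ.≮⇒≥ (does-false⁻ (col st u <? β) above)) (#-mono {n} {λ x → found st x u} (λ x eq → ∧-true⁺ eq refl)))

  -- Fresh entries are bounded by rows. The others lie in the columns of seen elements, at most r
  -- columns of at most β entries.
  found-count : ∀ {st} → Bounded st → (∀ u → seen st u ≡ true → u ∈ S) → sum (λ x → # (found st x)) ≤ n * h + ∣ S ∣ * β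
  found-count {st} bounded seen⊆S = begin
    sum (λ x → # (found st x))                            ≤⟨ sum-mono split ⟩
    sum (λ x → row st x + # (old x))                      ≡⟨ ∑-distrib-+ (row st) (# ∘ old) ⟩
    sum (row st) + sum (λ x → # (old x))                  ≡⟨ cong (sum (row st) +_) (∑-comm (λ x u → ⟦ old x u ⟧)) ⟩
    sum (row st) + sum (λ u → # (λ x → old x u))          ≤⟨ +-mono-≤ (sum-bounded h (Bounded.row-≤ bounded)) (sum-mono column) ⟩
    n * h + sum (λ u → ⟦ seen st u ⟧ * β)                 ≡⟨ cong (n * h +_) (sum-*ʳ (⟦_⟧ ∘ seen st) β) ⟩
    n * h + # (seen st) * β                               ≤⟨ ℕ.+-monoʳ-≤ (n * h) (ℕ.*-monoˡ-≤ β (#-⊆ seen⊆S)) ⟩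
    n * h + ∣ S ∣ * β                                     ∎
    where
    open ≤-Reasoning
    old : Fin n → Fin n → Bool
    old x u = seen st u ∧ found st x u
    split : ∀ x → # (found st x) ≤ row st x + # (old x)
    split x = ≤-trans (sum-mono pointwise) (≤-reflexive (∑-distrib-+ (⟦_⟧ ∘ fresh st x) (⟦_⟧ ∘ old x)))
      where
      pointwise : ∀ u → ⟦ found st x u ⟧ ≤ ⟦ fresh st x u ⟧ + ⟦ old x u ⟧
      pointwise u with found st x u | seen st u
      ... | false | _     = z≤n
      ... | true  | false = ≤-refl
      ... | true  | true  = ≤-refl
    column : ∀ u → # (λ x → old x u) ≤ ⟦ seen st u ⟧ * β
    column u with seen st u
    ... | true  = ≤-trans (Bounded.col-≤ bounded u) (≤-reflexive (sym (ℕ.*-identityˡ β)))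
    ... | false = ≤-trans (sum-bounded {n} 0 (λ _ → z≤n)) (≤-reflexive (ℕ.*-zeroʳ n))

  module _ (st : State n) (x u : Fin n) where

    add-mono : ∀ {y z} → found st y z ≡ true → found (add st x u) y z ≡ true
    add-mono eq rewrite eq = refl

    add-same : found (add st x u) x u ≡ true
    add-same with x Fin.≟ x | u Fin.≟ u
    ... | yes _   | yes _   = Bool.∨-zeroʳ _
    ... | no  x≢x | _       = contradiction refl x≢x
    ... | yes _   | no  u≢u = contradiction refl u≢u

    add-true⁻ : ∀ {y z} → found (add st x u) y z ≡ true → found st y z ≡ true ⊎ (y ≡ x × z ≡ u)
    add-true⁻ {y} {z} eq with found st y z | y Fin.≟ x | z Fin.≟ u
    ... | true  | _        | _        = inj₁ refl
    ... | false | yes refl | yes refl = inj₂ (refl , refl)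
    ... | false | yes _    | no  _    = contradiction eq false≢true
    ... | false | no  _    | _        = contradiction eq false≢true

    fresh-mono : ∀ {y} z → fresh st y z ≡ true → fresh (add st x u) y z ≡ true
    fresh-mono z eq = let yz , new = ∧-true⁻ eq in ∧-true⁺ (add-mono yz) new

    fresh-true⁻ : ∀ {y} z → fresh (add st x u) y z ≡ true → fresh st y z ≡ true ⊎ (y ≡ x × z ≡ u)
    fresh-true⁻ z eq with ∧-true⁻ eq
    ... | yz , new with add-true⁻ yz
    ...   | inj₁ yz = inj₁ (∧-true⁺ yz new)
    ...   | inj₂ eqs = inj₂ eqs

    row-mono : ∀ y → row st y ≤ row (add st x u) y
    row-mono y = #-mono fresh-mono

    row-other : ∀ {y} → y ≢ x → row (add st x u) y ≤ row st y
    row-other y≢x = #-mono (λ z eq → case fresh-true⁻ z eq of λ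
      { (inj₁ eq) → eq ; (inj₂ (y≡x , _)) → contradiction y≡x y≢x })

    row-same : seen st u ≡ false → found st x u ≡ false → row (add st x u) x ≡ suc (row st x)
    row-same new unfound = ℕ.≤-antisym
      (sum-bump u (λ z z≢u → ⟦⟧-mono (λ eq → case fresh-true⁻ z eq of λ
        { (inj₁ eq) → eq ; (inj₂ (_ , z≡u)) → contradiction z≡u z≢u })) (≤-trans (⟦⟧≤1 _) (s≤s z≤n)))
      (#-mono-< fresh-mono u (trans (cong (_∧ _) unfound) refl) (∧-true⁺ add-same (not-true⁺ new)))

    col-other : ∀ {z} → z ≢ u → col (add st x u) z ≤ col st z
    col-other {z} z≢u = #-mono {p = λ y → found (add st x u) y z} {λ y → found st y z} (λ y eq → case add-true⁻ eq of λ
      { (inj₁ eq) → eq ; (inj₂ (_ , z≡u)) → contradiction z≡u z≢u })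

    col-same : col (add st x u) u ≤ suc (col st u)
    col-same = sum-bump x (λ y y≢x → ⟦⟧-mono (λ eq → case add-true⁻ eq of λ
      { (inj₁ eq) → eq ; (inj₂ (y≡x , _)) → contradiction y≡x y≢x })) (≤-trans (⟦⟧≤1 _) (s≤s z≤n))

    found-< : found st x u ≡ false → sum (λ y → # (found st y)) < sum (λ y → # (found (add st x u) y))
    found-< unfound = sum-mono-< (λ y → #-mono {p = found st y} (λ z → add-mono)) x
      (#-mono-< {p = found st x} {found (add st x u) x} (λ z → add-mono) u unfound add-same)

    add-bounded : Bounded st → seen st u ≡ false → found st x u ≡ false → row st x < h → col st u < β → Bounded (add st x u)
    add-bounded bounded new unfound row<h col<β = record { row-≤ = row-≤′ ; col-≤ = col-≤′ }
      where
      open Bounded bounded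
      row-≤′ : ∀ y → row (add st x u) y ≤ h
      row-≤′ y = case y Fin.≟ x of λ
        { (yes refl) → ≤-trans (≤-reflexive (row-same new unfound)) row<h
        ; (no  y≢x)  → ≤-trans (row-other y≢x) (row-≤ y) }
      col-≤′ : ∀ z → col (add st x u) z ≤ β
      col-≤′ z = case z Fin.≟ u of λ
        { (yes refl) → ≤-trans col-same col<β
        ; (no  z≢u)  → ≤-trans (col-other z≢u) (col-≤ z) }

-- Amortised cost of the classification

module Refresh {n : ℕ} {I₁ I₂ : Subset n → Bool} (mat₁ : IsMatroid I₁) (mat₂ : IsMatroid I₂)
               {S : Subset n} (common : CommonIndep I₁ I₂ S)
               {sources targets : List (Fin n)} (src : Table I₁ S sources) (tgt : Table I₂ S targets)
               (h β p : ℕ) (0<β : 0 < β) (nh≤pβ : n * h ≤ p * β) where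

  open State
  open FindLast mat₁ mat₂ common
  open Shorten mat₁ mat₂ common src tgt
  open Search mat₁ mat₂ common src tgt

  -- Every query of a refresh is paid for by a newly found exchange or a newly light element.
  potential : State n → ℕ
  potential st = sum (λ x → # (found st x)) + suc p * # (light st)

  record Refreshed (st st′ : State n) (c : ℕ) : Set where
    field
      sound   : Sound st′
      bounded : Bounded S h β st′
      same    : seen st′ ≡ seen st
      ready   : ∀ {x} → Ready S h β st x → Ready S h β st′ x
      pay     : c + cost * potential st ≤ cost * potential st′

  open Refreshed

  refreshed-refl : ∀ {st} → Sound st → Bounded S h β st → Refreshed st st 0
  refreshed-refl sound bounded = record { sound = sound ; bounded = bounded ; same = refl ; ready = id ; pay = ≤-refl }

  refreshed-trans : ∀ {st₁ st₂ st₃ c d} → Refreshed st₁ st₂ c → Refreshed st₂ st₃ d → Refreshed st₁ st₃ (c + d)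
  refreshed-trans {st₁} {c = c} {d} r₁ r₂ = record
    { sound = sound r₂ ; bounded = bounded r₂ ; same = trans (same r₂) (same r₁) ; ready = ready r₂ ∘ ready r₁
    ; pay = ≤-trans (≤-reflexive (trans (cong (_+ cost * potential st₁) (ℕ.+-comm c d)) (ℕ.+-assoc d c _)))
                    (≤-trans (ℕ.+-monoʳ-≤ d (pay r₁)) (pay r₂)) }

  refreshed-cheaper : ∀ {st st′ c d} → c ≤ d → Refreshed st st′ d → Refreshed st st′ c
  refreshed-cheaper c≤d r = record
    { sound = sound r ; bounded = bounded r ; same = same r ; ready = ready r ; pay = ≤-trans (ℕ.+-monoˡ-≤ _ c≤d) (pay r) }

  add-refreshed : ∀ {st x u} → Sound st → Bounded S h β st → x ∉ S → u ∈ S → available S h β st x u ≡ true →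
                  row S h β st x < h → swap two x u ≡ true → Refreshed st (add S h β st x u) cost
  add-refreshed {st} {x} {u} sound bounded x∉S u∈S avail row<h xu =
    let new , rest′ = ∧-true⁻ avail
        unfound , below = ∧-true⁻ rest′
    in record
    { sound   = record
      { seen-sound  = seen-sound
      ; found-sound = λ eq → case add-true⁻ S h β st x u eq of λ { (inj₁ eq) → found-sound eq ; (inj₂ (refl , refl)) → x∉S , u∈S , xu }
      ; rest-sound  = rest-sound
      ; light-complete = λ lt u∈S new sw → case light-complete lt u∈S new sw of λ
          { (inj₁ eq) → inj₁ (add-mono S h β st x u eq) ; (inj₂ u∈) → inj₂ u∈ }
      }
    ; bounded = add-bounded S h β st x u bounded (not-true⁻ new) (not-true⁻ unfound) row<h (does-true⁻ (_ <? β) below)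
    ; same    = refl
    ; ready   = λ { (inj₁ lt) → inj₁ lt ; (inj₂ h≤) → inj₂ (≤-trans h≤ (row-mono S h β st x u _)) }
    ; pay     = ≤-trans (≤-reflexive (sym (ℕ.*-suc cost (potential st))))
                  (ℕ.*-monoʳ-≤ cost (ℕ.+-monoˡ-≤ (suc p * # (light st)) (found-< S h β st x u (not-true⁻ unfound))))
    }
    where open Sound sound

  lighten-refreshed : ∀ {st x us} → Sound st → Bounded S h β st → light st x ≡ false →
    (∀ {u} → u ∈ₗ us → swap two x u ≡ true) →
    (∀ {u} → u ∈ S → seen st u ≡ false → swap two x u ≡ true → found st x u ≡ true ⊎ u ∈ₗ us) →
    Refreshed st (lighten S h β st x us) (cost * suc p)
  lighten-refreshed {st} {x} {us} sound bounded heavy us-sound us-complete = record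
    { sound   = record
      { seen-sound = seen-sound ; found-sound = found-sound ; rest-sound = rest-sound′ ; light-complete = light-complete′ }
    ; bounded = record { row-≤ = row-≤ ; col-≤ = col-≤ }
    ; same    = refl
    ; ready   = λ { (inj₁ lt) → inj₁ (≔-true (light st) x lt) ; (inj₂ h≤) → inj₂ h≤ }
    ; pay     = begin
        cost * suc p + cost * (F + suc p * # (light st))   ≡⟨ ℕ.*-distribˡ-+ cost (suc p) _ ⟨
        cost * (suc p + (F + suc p * # (light st)))        ≡⟨ cong (cost *_) (trans (sym (ℕ.+-assoc (suc p) F _))
                                                               (trans (cong (_+ suc p * # (light st)) (ℕ.+-comm (suc p) F)) (ℕ.+-assoc F (suc p) _))) ⟩
        cost * (F + (suc p + suc p * # (light st)))        ≡⟨ cong (λ m → cost * (F + m)) (ℕ.*-suc (suc p) (# (light st))) ⟨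
        cost * (F + suc p * suc (# (light st)))            ≤⟨ ℕ.*-monoʳ-≤ cost (ℕ.+-monoʳ-≤ F (ℕ.*-monoʳ-≤ (suc p)
                                                               (#-mono-< (λ _ → ≔-true (light st) x) x heavy (≔-same (light st) x true)))) ⟩
        cost * (F + suc p * # (light st [ x ≔ true ]))     ∎
    }
    where
    open ≤-Reasoning
    open Sound sound
    open Bounded bounded
    F = sum (λ x → # (found st x))
    rest-sound′ : ∀ {y u} → (light st [ x ≔ true ]) y ≡ true → u ∈ₗ (rest st [ x ≔ us ]) y → swap two y u ≡ true
    rest-sound′ {y} lt u∈ with y Fin.≟ x
    ... | yes refl = us-sound u∈
    ... | no  _    = rest-sound lt u∈
    light-complete′ : ∀ {y u} → (light st [ x ≔ true ]) y ≡ true → u ∈ S → seen st u ≡ false → swap two y u ≡ true →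
                      found st y u ≡ true ⊎ u ∈ₗ (rest st [ x ≔ us ]) y
    light-complete′ {y} lt with y Fin.≟ x
    ... | yes refl = us-complete
    ... | no  _    = light-complete lt

  Refreshes : Fin n → State n → OracleAlg n (State n) → Set
  Refreshes x st m = Refreshed st (output I₁ I₂ m) (queries I₁ I₂ m) × Ready S h β (output I₁ I₂ m) x

  -- The fuel is the number of fresh entries that x lacks for being heavy, so running out of it
  -- makes x heavy.
  refresh-spec : ∀ f x st → x ∉ S → Sound st → Bounded S h β st → row S h β st x + f ≡ h → Refreshes x st (refresh S h β f x st)
  extend-spec : ∀ f x st → x ∉ S → Sound st → Bounded S h β st → row S h β st x + suc f ≡ h → light st x ≡ false →
    ∀ r → Last (swap two x) (members S (available S h β st x)) r →
    Refreshed st (output I₁ I₂ (extend S h β f x st r)) (cost + queries I₁ I₂ (extend S h β f x st r)) ×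
    Ready S h β (output I₁ I₂ (extend S h β f x st r)) x

  refresh-spec zero x st x∉S sound bounded full =
    refreshed-refl sound bounded , inj₂ (≤-reflexive (trans (sym full) (ℕ.+-identityʳ _)))
  refresh-spec (suc f) x st x∉S sound bounded full with light st x in lt
  ... | true  = refreshed-refl sound bounded , inj₁ lt
  ... | false with findLast-spec two x∉S id (members S (available S h β st x)) (members-∈ S _) (length-members S _)
  ...   | last , q
    rewrite output->>= I₁ I₂ (findLast S two x id (members S (available S h β st x))) (extend S h β f x st)
          | queries->>= I₁ I₂ (findLast S two x id (members S (available S h β st x))) (extend S h β f x st)
    = let refreshed , rdy = extend-spec f x st x∉S sound bounded full lt _ last
      in refreshed-cheaper (ℕ.+-monoˡ-≤ _ q) refreshed , rdy

  extend-spec f x st x∉S sound bounded full lt _ (some {pre} {u} eq xu _) =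
    let u∈S , avail = ∈-members⁻ {p = available S h β st x} (subst (u ∈ₗ_) (sym eq) (∈-++⁺ʳ pre (here refl)))
        new , rest′ = ∧-true⁻ avail
        unfound , _ = ∧-true⁻ rest′
        step₁ = add-refreshed sound bounded x∉S u∈S avail
                  (≤-trans (≤-trans (s≤s (ℕ.m≤m+n _ f)) (≤-reflexive (sym (ℕ.+-suc _ f)))) (≤-reflexive full)) xu
        step₂ , rdy = refresh-spec f x (add S h β st x u) x∉S (Refreshed.sound step₁) (Refreshed.bounded step₁)
                        (trans (cong (_+ f) (row-same S h β st x u (not-true⁻ new) (not-true⁻ unfound))) (trans (sym (ℕ.+-suc _ f)) full))
    in refreshed-trans step₁ step₂ , rdy
  extend-spec f x st x∉S sound bounded full lt _ (none misses)
    rewrite output-filterAsk->>= I₁ I₂ two (λ u → (S - u) ∪ ⁅ x ⁆) (members S (popular S h β st)) (ret ∘ lighten S h β st x)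
          | queries-filterAsk->>= I₁ I₂ two (λ u → (S - u) ∪ ⁅ x ⁆) (members S (popular S h β st)) (ret ∘ lighten S h β st x)
    = refreshed-cheaper paid (lighten-refreshed sound bounded lt
        (λ u∈ → proj₂ (∈-filter⁻ swap? {xs = members S (popular S h β st)} u∈)) complete)
      , inj₁ (≔-same (light st) x true)
    where
    swap? = λ u → swap two x u Bool.≟ true
    -- One `cost` pays for the failed search and `cost * p` for the at most p single tests. This is
    -- why a light element weighs `suc p` in the potential.
    paid : cost + (length (members S (popular S h β st)) + 0) ≤ cost * suc p
    paid = ≤-trans (ℕ.+-monoʳ-≤ cost (≤-trans (≤-reflexive (ℕ.+-identityʳ _))
                     (≤-trans (popular-count S h β bounded p 0<β nh≤pβ) (ℕ.m≤m+n p _))))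
                   (≤-reflexive (sym (ℕ.*-suc cost p)))
    complete : ∀ {u} → u ∈ S → seen st u ≡ false → swap two x u ≡ true →
               found st x u ≡ true ⊎ u ∈ₗ filter swap? (members S (popular S h β st))
    complete {u} u∈S new xu with found st x u in unfound | does (col S h β st u <? β) in below
    ... | true  | _     = inj₁ refl
    ... | false | true  = contradiction
      (trans (sym (All.lookup misses (∈-members⁺ u∈S (∧-true⁺ (not-true⁺ new) (∧-true⁺ (not-true⁺ unfound) below))))) xu) false≢true
    ... | false | false = inj₂ (∈-filter⁺ swap? (∈-members⁺ u∈S (∧-true⁺ (not-true⁺ new) (not-true⁺ below))) xu)

  refreshAll-spec : ∀ xs st → All (_∉ S) xs → Sound st → Bounded S h β st →
    Refreshed st (output I₁ I₂ (refreshAll S h β xs st)) (queries I₁ I₂ (refreshAll S h β xs st)) ×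
    (∀ {x} → x ∈ₗ xs → Ready S h β (output I₁ I₂ (refreshAll S h β xs st)) x)
  refreshAll-spec [] st _ sound bounded = refreshed-refl sound bounded , λ ()
  refreshAll-spec (x ∷ xs) st (x∉S ∷ xs∉S) sound bounded
    with refresh-spec (h ∸ row S h β st x) x st x∉S sound bounded (ℕ.m+[n∸m]≡n (Bounded.row-≤ bounded x))
  ... | r₁ , rdy
    rewrite output->>= I₁ I₂ (refresh S h β (h ∸ row S h β st x) x st) (refreshAll S h β xs)
          | queries->>= I₁ I₂ (refresh S h β (h ∸ row S h β st x) x st) (refreshAll S h β xs)
    = let r₂ , rdys = refreshAll-spec xs _ xs∉S (Refreshed.sound r₁) (Refreshed.bounded r₁)
      in refreshed-trans r₁ r₂ , λ { (here refl) → Refreshed.ready r₂ rdy ; (there x∈) → rdys x∈ }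

-- The algorithm

module _ {n : ℕ} (S : Subset n) (sources targets : List (Fin n)) (h β : ℕ) where
  open State

  grow : State n → List (Fin n × Fin n) → Fin n → State n
  grow st σ w = record st
    { seen = λ u → seen st u ∨ found st w u
    ; via  = λ u → if seen st u then via st u else (σ , w) }

  loop     : ℕ → State n → OracleAlg n (Answer n)
  pursue   : ℕ → State n → OracleAlg n (Answer n)
  decide   : ℕ → State n → Maybe (List (Fin n × Fin n) × Fin n) → OracleAlg n (Answer n)
  conclude : ∀ {w} → ℕ → State n → List (Fin n × Fin n) → Dec (w ∈ₗ targets) → OracleAlg n (Answer n)

  -- Never reached from the initial state: more than r elements of S would have to be seen.
  loop zero    st = ret maximum
  loop (suc f) st = refreshAll S h β (elements (not ∘ lookup S)) st >>= pursue f

  pursue f st = search S sources targets st n (λ _ → false) (λ x → x , []) >>= decide f st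

  decide f st nothing         = ret maximum
  decide f st (just (σ , w)) = conclude f st σ (w ∈?ₗ targets)

  conclude {w} f st σ (yes _) = augment S sources targets σ w >>= (ret ∘ augmenting)
  conclude {w} f st σ (no  _) = loop f (grow st σ w)

-- Correctness and cost of the main loop

module Loop {n : ℕ} {I₁ I₂ : Subset n → Bool} (mat₁ : IsMatroid I₁) (mat₂ : IsMatroid I₂)
            {S : Subset n} (common : CommonIndep I₁ I₂ S)
            {sources targets : List (Fin n)} (src : Table I₁ S sources) (tgt : Table I₂ S targets)
            (h β p : ℕ) (0<β : 0 < β) (nh≤pβ : n * h ≤ p * β) where

  open State
  open FindLast mat₁ mat₂ common
  open Shorten mat₁ mat₂ common src tgt
  open Search mat₁ mat₂ common src tgt
  open Refresh mat₁ mat₂ common src tgt h β p 0<β nh≤pβ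

  module _ {st : State n} {σ : List (Fin n × Fin n)} {w : Fin n} where

    grow-seen⁻ : ∀ {u} → seen (grow S sources targets h β st σ w) u ≡ false → seen st u ≡ false
    grow-seen⁻ {u} eq with seen st u
    ... | false = refl

    grow-sound : Sound st → Reach σ w → Sound (grow S sources targets h β st σ w)
    grow-sound sound walk = record
      { seen-sound = seen-sound′ ; found-sound = found-sound ; rest-sound = rest-sound
      ; light-complete = λ lt u∈S new → light-complete lt u∈S (grow-seen⁻ new) }
      where
      open Sound sound
      via′ = via (grow S sources targets h β st σ w)
      seen-sound′ : ∀ {u} → seen st u ∨ found st w u ≡ true →
                    u ∈ S × swap two (proj₂ (via′ u)) u ≡ true × Reach (proj₁ (via′ u)) (proj₂ (via′ u))
      seen-sound′ {u} eq with seen st u in old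
      ... | true  = seen-sound old
      ... | false = let _ , u∈S , wu = found-sound eq in u∈S , wu , walk

    grow-bounded : Bounded S h β st → Bounded S h β (grow S sources targets h β st σ w)
    grow-bounded bounded = record
      { row-≤ = λ x → ≤-trans (#-mono {p = fresh (grow S sources targets h β st σ w) x} {fresh st x} (λ u eq → let xu , new = ∧-true⁻ eq in ∧-true⁺ xu (not-true⁺ (grow-seen⁻ (not-true⁻ new))))) (row-≤ x)
      ; col-≤ = col-≤ }
      where open Bounded bounded

    -- The fresh entries of w are unseen by definition, so each of them is a gain.
    grow-count : # (seen st) + row S h β st w ≤ # (seen (grow S sources targets h β st σ w))
    grow-count = ≤-trans (≤-reflexive (sym (∑-distrib-+ (⟦_⟧ ∘ seen st) (⟦_⟧ ∘ fresh st w)))) (sum-mono pointwise)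
      where
      pointwise : ∀ u → ⟦ seen st u ⟧ + ⟦ fresh st w u ⟧ ≤ ⟦ seen st u ∨ found st w u ⟧
      pointwise u with seen st u | found st w u
      ... | true  | true  = ≤-refl
      ... | true  | false = ≤-refl
      ... | false | true  = ≤-refl
      ... | false | false = ≤-refl

  potential-bound : ℕ
  potential-bound = (n * h + ∣ S ∣ * β) + suc p * n

  potential-≤ : ∀ {st} → Sound st → Bounded S h β st → potential st ≤ potential-bound
  potential-≤ {st} sound bounded = +-mono-≤ (found-count S h β bounded (λ u → proj₁ ∘ Sound.seen-sound sound))
    (ℕ.*-monoʳ-≤ (suc p) (≤-trans (#-mono {n} {light st} {λ _ → true} (λ _ _ → refl)) (≤-reflexive (#-true n))))

  -- In units of `cost`: all refreshing, then n for each of f backward searches, then two for each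
  -- of the at most r rounds of the final shortening.
  budget : ℕ → ℕ
  budget f = potential-bound + (f * n + (∣ S ∣ + ∣ S ∣))

  Solves : ℕ → State n → OracleAlg n (Answer n) → Set
  Solves f st m = Correct I₁ I₂ S (output I₁ I₂ m) × queries I₁ I₂ m + cost * potential st ≤ cost * budget f

  -- A round that does not finish has reached a heavy w, and h further elements become seen. Thus
  -- the lower bound on seen elements plus `f * h` survives the loss of one unit of fuel, and at
  -- fuel zero it contradicts that seen elements lie in S.
  loop-spec : ∀ f st → Sound st → Bounded S h β st → ∣ S ∣ < # (seen st) + f * h → Solves f st (loop S sources targets h β f st)
  pursue-spec : ∀ f st → Sound st → Bounded S h β st → (∀ {x} → x ∉ S → Ready S h β st x) →
    ∣ S ∣ < # (seen st) + suc f * h → Solves (suc f) st (pursue S sources targets h β f st)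
  decide-spec : ∀ f st (sound : Sound st) → Bounded S h β st → (∀ {x} → x ∉ S → Ready S h β st x) →
    ∣ S ∣ < # (seen st) + suc f * h → ∀ r → Found sound r → Solves f st (decide S sources targets h β f st r)
  conclude-spec : ∀ f st σ w → Sound st → Bounded S h β st → Reach σ w → (w ∉ₗ targets → h ≤ row S h β st w) →
    ∣ S ∣ < # (seen st) + suc f * h → ∀ d → Solves f st (conclude S sources targets h β {w} f st σ d)

  loop-spec zero st sound bounded enough = contradiction
    (≤-trans enough (≤-trans (≤-reflexive (ℕ.+-identityʳ _)) (#-⊆ (λ u → proj₁ ∘ Sound.seen-sound sound)))) (ℕ.<-irrefl refl)
  loop-spec (suc f) st sound bounded enough
    with refreshAll-spec (elements (not ∘ lookup S)) st
           (All.tabulate λ x∈ x∈S → false≢true (trans (sym (not-true⁻ (∈-elements⁻ {p = not ∘ lookup S} x∈))) ([]=⇒lookup x∈S)))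
           sound bounded
  ... | r , ready
    rewrite output->>= I₁ I₂ (refreshAll S h β (elements (not ∘ lookup S)) st) (pursue S sources targets h β f)
          | queries->>= I₁ I₂ (refreshAll S h β (elements (not ∘ lookup S)) st) (pursue S sources targets h β f)
    = let correct , paid = pursue-spec f _ (Refreshed.sound r) (Refreshed.bounded r)
            (λ x∉S → ready (∈-elements⁺ {p = not ∘ lookup S} (not-true⁺ (≢true (x∉S ∘ lookup⇒[]= _ S)))))
            (subst (λ s → ∣ S ∣ < # s + suc f * h) (sym (Refreshed.same r)) enough)
      in correct , pay (queries I₁ I₂ (refreshAll S h β (elements (not ∘ lookup S)) st)) _ (Refreshed.pay r) paid
    where
    pay : ∀ a b {c d e} → a + c ≤ d → b + d ≤ e → (a + b) + c ≤ e
    pay a b {c} a+c≤d b+d≤e = ≤-trans (≤-reflexive (trans (cong (_+ c) (ℕ.+-comm a b)) (ℕ.+-assoc b a c)))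
      (≤-trans (ℕ.+-monoʳ-≤ b a+c≤d) b+d≤e)

  pursue-spec f st sound bounded ready enough
    with search-spec sound n (λ _ → false) (λ x → x , []) record
           { fuel = ℕ.m≤n+m n _ ; marked-in = λ _ () ; marked-out = λ _ () }
  ... | found , q
    rewrite output->>= I₁ I₂ (search S sources targets st n (λ _ → false) (λ x → x , [])) (decide S sources targets h β f st)
          | queries->>= I₁ I₂ (search S sources targets st n (λ _ → false) (λ x → x , [])) (decide S sources targets h β f st)
    = let correct , paid = decide-spec f st sound bounded ready enough _ found in correct , pay _ _ q paid
    where
    pay : ∀ a b {c} → a ≤ n * cost → b + c ≤ cost * budget f → (a + b) + c ≤ cost * budget (suc f)
    pay a b {c} a≤ b+c≤ = ≤-trans (≤-reflexive (ℕ.+-assoc a b c)) (≤-trans (+-mono-≤ a≤ b+c≤) (≤-reflexive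
      (solve 5 (λ n k P m r → n :* k :+ k :* (P :+ (m :+ r)) := k :* (P :+ ((n :+ m) :+ r))) refl
        n cost potential-bound (f * n) (∣ S ∣ + ∣ S ∣))))
      where open +-*-Solver

  decide-spec f st sound bounded ready enough nothing max =
    max , ℕ.*-monoʳ-≤ cost (≤-trans (potential-≤ sound bounded) (ℕ.m≤m+n _ _))
  decide-spec f st sound bounded ready enough (just (σ , w)) (walk , root) =
    conclude-spec f st σ w sound bounded walk (λ w∉T → heavy w∉T root (ready (reach-∉ walk))) enough (w ∈?ₗ targets)
    where
    heavy : w ∉ₗ targets → Root S sources targets st w → Ready S h β st w → h ≤ row S h β st w
    heavy w∉T (inj₁ w∈T)   _          = contradiction w∈T w∉T
    heavy w∉T (inj₂ heavy) (inj₁ lt)  = contradiction (trans (sym heavy) lt) false≢true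
    heavy w∉T (inj₂ _)     (inj₂ h≤) = h≤

  conclude-spec f st σ w sound bounded walk heavy enough (no w∉T) =
    loop-spec f (grow S sources targets h β st σ w) (grow-sound sound walk) (grow-bounded bounded) (begin
      suc ∣ S ∣                             ≤⟨ enough ⟩
      # (seen st) + (h + f * h)             ≡⟨ ℕ.+-assoc (# (seen st)) h _ ⟨
      (# (seen st) + h) + f * h             ≤⟨ ℕ.+-monoˡ-≤ (f * h) (ℕ.+-monoʳ-≤ (# (seen st)) (heavy w∉T)) ⟩
      (# (seen st) + row S h β st w) + f * h ≤⟨ ℕ.+-monoˡ-≤ (f * h) (grow-count {st} {σ} {w}) ⟩
      # (seen (grow S sources targets h β st σ w)) + f * h ∎)
    where open ≤-Reasoning
  conclude-spec f st σ w sound bounded walk heavy enough (yes w∈T)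
    rewrite output->>= I₁ I₂ (augment S sources targets σ w) (ret ∘ augmenting)
          | queries->>= I₁ I₂ (augment S sources targets σ w) (ret ∘ augmenting)
    = let good , q = augment-spec walk w∈T in good , (begin
      (queries I₁ I₂ (augment S sources targets σ w) + 0) + cost * potential st
        ≤⟨ +-mono-≤ (≤-trans (≤-reflexive (ℕ.+-identityʳ _)) q) (ℕ.*-monoʳ-≤ cost (potential-≤ sound bounded)) ⟩
      ∣ S ∣ * (cost + cost) + cost * potential-bound
        ≡⟨ solve 3 (λ r k P → r :* (k :+ k) :+ k :* P := k :* (P :+ (r :+ r))) refl ∣ S ∣ cost potential-bound ⟩
      cost * (potential-bound + (∣ S ∣ + ∣ S ∣))
        ≤⟨ ℕ.*-monoʳ-≤ cost (ℕ.+-monoʳ-≤ potential-bound (ℕ.m≤n+m _ (f * n))) ⟩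
      cost * budget f ∎)
    where
    open ≤-Reasoning
    open +-*-Solver

-- Choice of the parameters and the final bound

cube-root : ∀ r → ∃ λ j → suc r ≤ suc j ^ 3 × suc j ^ 3 ≤ 8 * suc r
cube-root zero = 0 , ≤-refl , s≤s z≤n
cube-root (suc r) with cube-root r
... | j , lower , upper with suc (suc r) ≤? suc j ^ 3
...   | yes lower′ = j , lower′ , ≤-trans upper (ℕ.*-monoʳ-≤ 8 (ℕ.n≤1+n (suc r)))
-- The root grows only when its cube is at most r + 1, and j + 2 is at most twice j + 1, whence the
-- factor 8.
...   | no  small  = suc j , ≤-trans (s≤s lower) (ℕ.^-monoˡ-< 3 (ℕ.n<1+n (suc j))) , (begin
  suc (suc j) ^ 3    ≤⟨ ℕ.^-monoˡ-≤ 3 (≤-trans (s≤s (ℕ.m≤n+m (suc j) j)) (≤-reflexive (cong (suc j +_) (sym (ℕ.+-identityʳ (suc j)))))) ⟩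
  (2 * suc j) ^ 3    ≡⟨ solve 1 (λ k → (con 2 :* k) :^ 3 := con 8 :* (k :^ 3)) refl (suc j) ⟩
  8 * suc j ^ 3      ≤⟨ ℕ.*-monoʳ-≤ 8 (ℕ.≤-pred (ℕ.≰⇒> small)) ⟩
  8 * suc r          ≤⟨ ℕ.*-monoʳ-≤ 8 (ℕ.n≤1+n (suc r)) ⟩
  8 * suc (suc r)    ∎)
  where
  open ≤-Reasoning
  open +-*-Solver

-- Cubing turns h² into h⁶, the square of h³, and h³ is linear in r + 1.
within-bound : ∀ a b n r h ℓ {Q} → Q ≤ a * (ℓ * (h * h * n)) → h ^ 3 ≤ b * suc r →
               Q ^ 3 ≤ (a ^ 3 * b ^ 2) * (n ^ 3 * suc r ^ 2 * ℓ ^ 3)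
within-bound a b n r h ℓ {Q} Q≤ h³≤ = begin
  Q ^ 3                                              ≤⟨ ℕ.^-monoˡ-≤ 3 Q≤ ⟩
  (a * (ℓ * (h * h * n))) ^ 3                        ≡⟨ solve 4 (λ a ℓ h n → (a :* (ℓ :* (h :* h :* n))) :^ 3 :=
                                                          a :^ 3 :* ((h :^ 3) :^ 2) :* (n :^ 3 :* ℓ :^ 3)) refl a ℓ h n ⟩
  a ^ 3 * (h ^ 3) ^ 2 * (n ^ 3 * ℓ ^ 3)              ≤⟨ ℕ.*-monoˡ-≤ (n ^ 3 * ℓ ^ 3) (ℕ.*-monoʳ-≤ (a ^ 3) (ℕ.^-monoˡ-≤ 2 h³≤)) ⟩
  a ^ 3 * (b * suc r) ^ 2 * (n ^ 3 * ℓ ^ 3)          ≡⟨ solve 5 (λ a b R n ℓ → a :^ 3 :* ((b :* R) :^ 2) :* (n :^ 3 :* ℓ :^ 3) :=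
                                                          (a :^ 3 :* b :^ 2) :* (n :^ 3 :* R :^ 2 :* ℓ :^ 3)) refl a b (suc r) n ℓ ⟩
  (a ^ 3 * b ^ 2) * (n ^ 3 * suc r ^ 2 * ℓ ^ 3)      ∎
  where
  open ≤-Reasoning
  open +-*-Solver

initial : ∀ {n} → State n
initial = state (λ _ → false) (λ u → [] , u) (λ _ _ → false) (λ _ → false) (λ _ → [])

table : ∀ {n} → (Subset n → Bool) → Subset n → List (Fin n)
table I S = filter (λ x → I (S ∪ ⁅ x ⁆) Bool.≟ true) (allFin _)

table-spec : ∀ {n} (I : Subset n → Bool) S → Table I S (table I S)
table-spec I S = record
  { sound    = λ x∈ → proj₂ (∈-filter⁻ (λ x → I (S ∪ ⁅ x ⁆) Bool.≟ true) {xs = allFin _} x∈)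
  ; complete = ∈-filter⁺ (λ x → I (S ∪ ⁅ x ⁆) Bool.≟ true) (∈-allFin _) }

module _ (n : ℕ) (S : Subset n) where

  h : ℕ
  h = suc (proj₁ (cube-root ∣ S ∣))

  -- One more than the rounded quotient, so that β is positive and `n * h ≤ h * h * β`. Hence p can
  -- be `h * h`.
  β : ℕ
  β = suc (n / h)

  search-targets : List (Fin n) → OracleAlg n (Answer n)
  search-targets sources = filterAsk two (λ x → S ∪ ⁅ x ⁆) (allFin n) >>= λ targets → loop S sources targets h β (h * h) initial

  algorithm : OracleAlg n (Answer n)
  algorithm = filterAsk one (λ x → S ∪ ⁅ x ⁆) (allFin n) >>= search-targets

  r≤n : ∣ S ∣ ≤ n
  r≤n = Subset.∣p∣≤n S

  r<h³ : ∣ S ∣ < h ^ 3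
  r<h³ = proj₁ (proj₂ (cube-root ∣ S ∣))

  nh≤hhβ : n * h ≤ h * h * β
  nh≤hhβ = begin
    n * h                    ≡⟨ cong (_* h) (m≡m%n+[m/n]*n n h) ⟩
    (n % h + n / h * h) * h  ≤⟨ ℕ.*-monoˡ-≤ h (ℕ.+-monoˡ-≤ (n / h * h) (ℕ.<⇒≤ (m%n<n n h))) ⟩
    (h + n / h * h) * h      ≡⟨ solve 2 (λ h q → (h :+ q :* h) :* h := h :* h :* (con 1 :+ q)) refl h (n / h) ⟩
    h * h * suc (n / h)      ∎
    where
    open ≤-Reasoning
    open +-*-Solver

  -- The left side is `budget (h * h)`. In multiples of h²n its five terms contribute 1, 2, 2, 1 and
  -- 2; the second uses r < h³ and that `n / h * h` is at most n.
  total-≤ : ((n * h + ∣ S ∣ * β) + suc (h * h) * n) + (h * h * n + (∣ S ∣ + ∣ S ∣)) ≤ 8 * (h * h * n)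
  total-≤ = ≤-trans (+-mono-≤ (+-mono-≤ (+-mono-≤ nh≤m rβ≤m+m) (ℕ.+-monoˡ-≤ m n≤m))
                              (ℕ.+-monoʳ-≤ m (+-mono-≤ (≤-trans r≤n n≤m) (≤-trans r≤n n≤m))))
    (≤-reflexive (solve 1 (λ m → ((m :+ (m :+ m)) :+ (m :+ m)) :+ (m :+ (m :+ m)) := con 8 :* m) refl m))
    where
    open +-*-Solver
    m = h * h * n
    n≤m : n ≤ m
    n≤m = ℕ.m≤n*m n (h * h)
    nh≤m : n * h ≤ m
    nh≤m = ≤-trans (≤-reflexive (ℕ.*-comm n h)) (ℕ.*-monoˡ-≤ n (ℕ.m≤m*n h h))
    rβ≤m+m : ∣ S ∣ * β ≤ m + m
    rβ≤m+m = ≤-trans (≤-reflexive (ℕ.*-suc ∣ S ∣ (n / h))) (+-mono-≤ (≤-trans r≤n n≤m)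
      (≤-trans (ℕ.*-monoˡ-≤ (n / h) (ℕ.<⇒≤ r<h³)) (≤-trans
        (≤-reflexive (solve 2 (λ h q → h :^ 3 :* q := h :* h :* (q :* h)) refl h (n / h)))
        (ℕ.*-monoʳ-≤ (h * h) (m/n*n≤m n h)))))

  algorithm-correct : ∀ {I₁ I₂} → IsMatroid I₁ → IsMatroid I₂ → CommonIndep I₁ I₂ S →
    Correct I₁ I₂ S (output I₁ I₂ algorithm) ×
    queries I₁ I₂ algorithm ≤ 18 * (suc ⌊log₂ suc ∣ S ∣ ⌋ * (h * h * n))
  algorithm-correct {I₁} {I₂} mat₁ mat₂ common
    rewrite output-filterAsk->>= I₁ I₂ one (λ x → S ∪ ⁅ x ⁆) (allFin n) search-targets
          | queries-filterAsk->>= I₁ I₂ one (λ x → S ∪ ⁅ x ⁆) (allFin n) search-targets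
          | output-filterAsk->>= I₁ I₂ two (λ x → S ∪ ⁅ x ⁆) (allFin n) (λ ts → loop S (table I₁ S) ts h β (h * h) initial)
          | queries-filterAsk->>= I₁ I₂ two (λ x → S ∪ ⁅ x ⁆) (allFin n) (λ ts → loop S (table I₁ S) ts h β (h * h) initial)
          | List.length-tabulate {n = n} id
    = proj₁ solved , (begin
      -- Each of the two tables takes n queries. As `cost` is ℓ + 1, at most 2ℓ, the constant is 1 +
      -- 1 + 2 · 8 = 18.
      n + (n + q)                              ≤⟨ +-mono-≤ n≤ (+-mono-≤ n≤ q≤) ⟩
      ℓ * m + (ℓ * m + (ℓ + ℓ) * (8 * m))      ≡⟨ solve 2 (λ ℓ m → ℓ :* m :+ (ℓ :* m :+ (ℓ :+ ℓ) :* (con 8 :* m)) :=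
                                                     con 18 :* (ℓ :* m)) refl ℓ m ⟩
      18 * (ℓ * m)                             ∎)
    where
    open ≤-Reasoning
    open +-*-Solver
    open Loop mat₁ mat₂ common (table-spec I₁ S) (table-spec I₂ S) h β (h * h) (s≤s z≤n) nh≤hhβ
    open Shorten mat₁ mat₂ common (table-spec I₁ S) (table-spec I₂ S) using (cost)
    ℓ = suc ⌊log₂ suc ∣ S ∣ ⌋
    m = h * h * n
    q = queries I₁ I₂ (loop S (table I₁ S) (table I₂ S) h β (h * h) initial)
    none≤ : ∀ k {c} → # {k} (λ _ → false) ≤ c
    none≤ k = ≤-trans (sum-bounded {k} 0 (λ _ → z≤n)) (≤-trans (≤-reflexive (ℕ.*-zeroʳ k)) z≤n)
    solved = loop-spec (h * h) initial
      record { seen-sound = λ () ; found-sound = λ () ; rest-sound = λ () ; light-complete = λ () }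
      record { row-≤ = λ _ → none≤ n ; col-≤ = λ _ → none≤ n }
      -- Since h³ exceeds r, `h * h` rounds gaining h elements each are enough.
      (≤-trans r<h³ (≤-trans (≤-reflexive (solve 1 (λ h → h :^ 3 := h :* h :* h) refl h)) (ℕ.m≤n+m _ _)))
    n≤ : n ≤ ℓ * m
    n≤ = ≤-trans (ℕ.m≤n*m n (h * h)) (ℕ.m≤n*m m ℓ)
    q≤ : q ≤ (ℓ + ℓ) * (8 * m)
    q≤ = ≤-trans (ℕ.m≤m+n q _) (≤-trans (proj₂ solved) (ℕ.*-mono-≤ (s≤s (ℕ.m≤n+m ℓ ⌊log₂ suc ∣ S ∣ ⌋)) total-≤))

-- Stated for variable constants because normalising C = 18³ · 8² in unary is infeasible.
from-bounds : ∀ a b →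
  (∀ n S {I₁ I₂} → IsMatroid I₁ → IsMatroid I₂ → CommonIndep I₁ I₂ S →
    Correct I₁ I₂ S (output I₁ I₂ (algorithm n S)) ×
    queries I₁ I₂ (algorithm n S) ≤ a * (suc ⌊log₂ suc ∣ S ∣ ⌋ * (h n S * h n S * n))) →
  (∀ n S → h n S ^ 3 ≤ b * suc ∣ S ∣) →
  ∃ λ (C : ℕ) → ∃ λ (alg : (n : ℕ) → Subset n → OracleAlg n (Answer n)) →
    ∀ (n : ℕ) (I₁ I₂ : Subset n → Bool) → IsMatroid I₁ → IsMatroid I₂ →
    ∀ (S : Subset n) → CommonIndep I₁ I₂ S →
    Correct I₁ I₂ S (output I₁ I₂ (alg n S)) × WithinBound C n ∣ S ∣ (queries I₁ I₂ (alg n S))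
from-bounds a b solves h³≤ = a ^ 3 * b ^ 2 , algorithm , λ n I₁ I₂ mat₁ mat₂ S common →
  let correct , q = solves n S mat₁ mat₂ common
  in correct , within-bound a b n ∣ S ∣ (h n S) (suc ⌊log₂ suc ∣ S ∣ ⌋) q (h³≤ n S)

theorem3p2 : ∃ λ (C : ℕ) → ∃ λ (alg : (n : ℕ) → Subset n → OracleAlg n (Answer n)) →
    ∀ (n : ℕ) (I₁ I₂ : Subset n → Bool) → IsMatroid I₁ → IsMatroid I₂ →
    ∀ (S : Subset n) → CommonIndep I₁ I₂ S →
    Correct I₁ I₂ S (output I₁ I₂ (alg n S)) ×
    WithinBound C n ∣ S ∣ (queries I₁ I₂ (alg n S))
theorem3p2 = from-bounds 18 8 algorithm-correct (λ n S → proj₂ (proj₂ (cube-root ∣ S ∣)))
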